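{- Let $r\ge 0$ be an integer. The vertex functor $V:m\mathcal G(r)\to\mathcal S(r+1)$ gives a homotopy equivalence of classifying spaces $$Bm\mathcal G(r)\simeq B\mathcal S(r+1)\simeq BS_{r+1},$$ where $S_n$ is the symmetric group on $n$ letters.
   Context: A (finite) graph $G$ consists of a finite set of vertices $G_0$, a finite set of edges $G_1$, a two-fold covering $\widetilde G_1\to G_1$ (a surjection with all fibers of size two) whose elements are called half-edges, and an incidence map $\partial:\widetilde G_1\to G_0$ (loops and multiple edges are allowed). Let $\tau$ be the free involution of $\widetilde G_1$ switching the two half-edges of each edge, and extend $\tau$ and $\partial$ to $G_0\coprod\widetilde G_1$ by the identity on $G_0$. A morphism of graphs $G\to G'$ is a map $G_0\coprod\widetilde G_1\to G_0'\coprod\widetilde G_1'$ commuting with $\tau$ and $\partial$. A graph monomorphism is a morphism $f$ of graphs that is injective as a map $G_0\coprod\widetilde G_1\to G_0'\coprod\widetilde G_1'$ and satisfies $f(G_0)=G_0'$ and $f(\widetilde G_1)\subseteq\widetilde G_1'$ (i.e. an isomorphism onto a spanning subgraph). $m\mathcal G(r)$ is the category whose objects are connected graphs with $r+1$ vertices and whose morphisms are graph monomorphisms. $\mathcal S(r+1)$ is the category of sets of cardinality $r+1$ and bijections. The vertex functor $V:m\mathcal G(r)\to\mathcal S(r+1)$ sends $G$ to its vertex set $G_0$. $B\mathcal C$ is the classifying space (geometric realization of the nerve) of a category $\mathcal C$, with categories replaced by equivalent small ones. -}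

module Defs where

open import Level using (Level; 0ℓ) renaming (suc to lsuc; _⊔_ to _⊔ˡ_)
open import Algebra.Bundles using (Group)
open import Data.Empty using (⊥-elim)
open import Data.Fin.Base as Fin using (Fin; toℕ; fromℕ; fromℕ<; opposite)
import Data.Fin.Permutation as Perm
import Data.Fin.Properties as Fin
open import Data.Nat.Base as ℕ using (ℕ; zero; suc; 2+; z≤n; s≤s)
import Data.Nat.Properties as ℕ
open import Data.Product.Base using (Σ; ∃; _×_; _,_; proj₁; proj₂)
open import Data.Product.Relation.Binary.Pointwise.NonDependent using (×-setoid)
open import Data.Rational.Base as ℚ using (ℚ; 0ℚ; 1ℚ)
import Data.Rational.Properties as ℚ
open import Data.Sum.Base as Sum using (_⊎_; inj₁; inj₂; [_,_])
open import Data.Sum.Properties using (inj₁-injective)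
open import Data.Unit.Base using (⊤; tt)
open import Data.Vec.Base using (Vec; []; _∷_; count; allFin)
open import Data.Vec.Functional using (Vector)
open import Data.Vec.Functional.Relation.Binary.Equality.Setoid using (≋-setoid)
open import Data.Vec.Properties using (count≤n)
open import Function.Base using (_∘_; id)
open import Function.Bundles using (Func; Inverse; _↔_; mk↔ₛ′)
open import Function.Construct.Composition using (_↔-∘_)
open import Function.Construct.Identity using (↔-id)
open import Function.Definitions using (Injective)
open import Relation.Binary.Bundles using (Setoid; Poset)
open import Relation.Binary.Construct.Closure.Equivalence as EqC using (EqClosure)
open import Relation.Binary.Construct.Closure.ReflexiveTransitive using (Star)
import Relation.Binary.Construct.On as On
open import Relation.Binary.Definitions using (_Respects_)
open import Relation.Binary.Morphism.Bundles using (PosetHomomorphism)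
open import Relation.Binary.Morphism.Construct.Composition using (posetHomomorphism)
import Relation.Binary.Morphism.Construct.Identity as Identity
open import Relation.Binary.PropositionalEquality.Core
  using (_≡_; refl; sym; trans; cong; subst)
open import Relation.Binary.Structures using (IsEquivalence)
open import Relation.Nullary.Decidable.Core using (yes; no)
open import Relation.Nullary.Negation.Core using (¬_)
open import Relation.Unary using (Pred; Decidable; _∈_; _⊆_; _∩_; U)

------------------------------------------------------------------------
-- Categories and functors

record Category (o ℓ e : Level) : Set (lsuc (o ⊔ˡ ℓ ⊔ˡ e)) where
  infix  4 _≈_ _⇒_
  infixr 9 _⊙_
  field
    Obj       : Set o
    _⇒_       : Obj → Obj → Set ℓ
    _≈_       : ∀ {A B} → A ⇒ B → A ⇒ B → Set e
    idn       : ∀ {A} → A ⇒ A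
    _⊙_       : ∀ {A B C} → B ⇒ C → A ⇒ B → A ⇒ C
    assoc     : ∀ {A B C D} (h : C ⇒ D) (g : B ⇒ C) (f : A ⇒ B) →
                (h ⊙ g) ⊙ f ≈ h ⊙ (g ⊙ f)
    identityˡ : ∀ {A B} (f : A ⇒ B) → idn ⊙ f ≈ f
    identityʳ : ∀ {A B} (f : A ⇒ B) → f ⊙ idn ≈ f
    equiv     : ∀ {A B} → IsEquivalence (_≈_ {A} {B})
    ⊙-resp-≈  : ∀ {A B C} {h i : B ⇒ C} {f g : A ⇒ B} →
                h ≈ i → f ≈ g → h ⊙ f ≈ i ⊙ g

  module Equiv {A B : Obj} = IsEquivalence (equiv {A} {B})

  -- Equality of two arrows together with their source and target.
  infix 4 _≋_
  data _≋_ {A B : Obj} (f : A ⇒ B) : ∀ {A′ B′} → A′ ⇒ B′ → Set (o ⊔ˡ ℓ ⊔ˡ e) where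
    same : {g : A ⇒ B} → f ≈ g → f ≋ g

  ≋-refl : ∀ {A B} {f : A ⇒ B} → f ≋ f
  ≋-refl = same Equiv.refl

  ≋-sym : ∀ {A B A′ B′} {f : A ⇒ B} {g : A′ ⇒ B′} → f ≋ g → g ≋ f
  ≋-sym (same p) = same (Equiv.sym p)

  ≋-trans : ∀ {A B A′ B′ A″ B″} {f : A ⇒ B} {g : A′ ⇒ B′} {h : A″ ⇒ B″} →
            f ≋ g → g ≋ h → f ≋ h
  ≋-trans (same p) (same q) = same (Equiv.trans p q)

record Functor {o ℓ e o′ ℓ′ e′} (C : Category o ℓ e) (D : Category o′ ℓ′ e′) :
               Set (o ⊔ˡ ℓ ⊔ˡ e ⊔ˡ o′ ⊔ˡ ℓ′ ⊔ˡ e′) where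
  private
    module C = Category C
    module D = Category D
  field
    F₀           : C.Obj → D.Obj
    F₁           : ∀ {A B} → A C.⇒ B → F₀ A D.⇒ F₀ B
    identity     : ∀ {A} → F₁ (C.idn {A}) D.≈ D.idn
    homomorphism : ∀ {A B E} (g : B C.⇒ E) (f : A C.⇒ B) →
                   F₁ (g C.⊙ f) D.≈ F₁ g D.⊙ F₁ f
    F-resp-≈     : ∀ {A B} {f g : A C.⇒ B} → f C.≈ g → F₁ f D.≈ F₁ g

  F-resp-≋ : ∀ {A B A′ B′} {f : A C.⇒ B} {g : A′ C.⇒ B′} →
             f C.≋ g → F₁ f D.≋ F₁ g
  F-resp-≋ (C.same p) = D.same (F-resp-≈ p)

infixr 9 _∘F_
_∘F_ : ∀ {o ℓ e o′ ℓ′ e′ o″ ℓ″ e″}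
         {C : Category o ℓ e} {D : Category o′ ℓ′ e′} {E : Category o″ ℓ″ e″} →
       Functor D E → Functor C D → Functor C E
_∘F_ {E = E} G F = record
  { F₀           = G.F₀ ∘ F.F₀
  ; F₁           = G.F₁ ∘ F.F₁
  ; identity     = E.Equiv.trans (G.F-resp-≈ F.identity) G.identity
  ; homomorphism = λ g f →
      E.Equiv.trans (G.F-resp-≈ (F.homomorphism g f)) (G.homomorphism _ _)
  ; F-resp-≈     = G.F-resp-≈ ∘ F.F-resp-≈
  }
  where
    module E = Category E
    module G = Functor G
    module F = Functor F

-- Functors under strict equality (on objects as well as on arrows).
functorSetoid : ∀ {o ℓ e o′ ℓ′ e′} → Category o ℓ e → Category o′ ℓ′ e′ →
                Setoid _ _
functorSetoid C D = record
  { Carrier       = Functor C D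
  ; _≈_           = λ F G → ∀ {A B} (f : A C.⇒ B) → Functor.F₁ F f D.≋ Functor.F₁ G f
  ; isEquivalence = record
    { refl  = λ _ → D.≋-refl
    ; sym   = λ p f → D.≋-sym (p f)
    ; trans = λ p q f → D.≋-trans (p f) (q f)
    }
  }
  where
    module C = Category C
    module D = Category D

posetCategory : ∀ {a ℓ₁ ℓ₂} → Poset a ℓ₁ ℓ₂ → Category a ℓ₂ 0ℓ
posetCategory P = record
  { Obj       = P.Carrier
  ; _⇒_       = P._≤_
  ; _≈_       = λ _ _ → ⊤
  ; idn       = P.refl
  ; _⊙_       = λ g f → P.trans f g
  ; assoc     = λ _ _ _ → tt
  ; identityˡ = λ _ → tt
  ; identityʳ = λ _ → tt
  ; equiv     = record { refl = tt ; sym = λ _ → tt ; trans = λ _ _ → tt }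
  ; ⊙-resp-≈  = λ _ _ → tt
  }
  where module P = Poset P

posetFunctor : ∀ {a ℓ₁ ℓ₂ b ℓ₃ ℓ₄} {P : Poset a ℓ₁ ℓ₂} {Q : Poset b ℓ₃ ℓ₄} →
               PosetHomomorphism P Q → Functor (posetCategory P) (posetCategory Q)
posetFunctor f = record
  { F₀           = PosetHomomorphism.⟦_⟧ f
  ; F₁           = PosetHomomorphism.mono f
  ; identity     = tt
  ; homomorphism = λ _ _ → tt
  ; F-resp-≈     = λ _ → tt
  }

-- The category with one object whose endomorphisms are the elements of G.
oneObject : ∀ {c ℓ} → Group c ℓ → Category 0ℓ c ℓ
oneObject G = record
  { Obj       = ⊤
  ; _⇒_       = λ _ _ → G.Carrier
  ; _≈_       = G._≈_
  ; idn       = G.ε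
  ; _⊙_       = G._∙_
  ; assoc     = G.assoc
  ; identityˡ = G.identityˡ
  ; identityʳ = G.identityʳ
  ; equiv     = G.isEquivalence
  ; ⊙-resp-≈  = G.∙-cong
  }
  where module G = Group G

------------------------------------------------------------------------
-- Simplicial sets and the nerve

⟨_⟩ : ℕ → Poset 0ℓ 0ℓ 0ℓ
⟨ n ⟩ = Fin.≤-poset (suc n)

-- Morphisms ⟨ m ⟩ → ⟨ n ⟩ of the simplex category.
Mono : ℕ → ℕ → Set
Mono m n = PosetHomomorphism ⟨ m ⟩ ⟨ n ⟩

open PosetHomomorphism using (⟦_⟧)

record SimplicialSet (c ℓ : Level) : Set (lsuc (c ⊔ˡ ℓ)) where
  field
    simplices : ℕ → Setoid c ℓ

  Simplex : ℕ → Set c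
  Simplex n = Setoid.Carrier (simplices n)

  infix 4 _≈_
  _≈_ : ∀ {n} → Simplex n → Simplex n → Set ℓ
  _≈_ {n} = Setoid._≈_ (simplices n)

  field
    act       : ∀ {m n} → Mono m n → Simplex n → Simplex m
    act-cong  : ∀ {m n} {α β : Mono m n} {x y : Simplex n} →
                (∀ i → ⟦ α ⟧ i ≡ ⟦ β ⟧ i) → x ≈ y → act α x ≈ act β y
    act-id    : ∀ {n} (x : Simplex n) → act (Identity.posetHomomorphism ⟨ n ⟩) x ≈ x
    act-∘     : ∀ {l m n} (α : Mono l m) (β : Mono m n) (x : Simplex n) →
                act (posetHomomorphism α β) x ≈ act α (act β x)

record SimplicialMap {c ℓ c′ ℓ′} (X : SimplicialSet c ℓ) (Y : SimplicialSet c′ ℓ′) :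
                     Set (c ⊔ˡ ℓ ⊔ˡ c′ ⊔ˡ ℓ′) where
  private
    module X = SimplicialSet X
    module Y = SimplicialSet Y
  field
    map      : ∀ {n} → X.Simplex n → Y.Simplex n
    map-cong : ∀ {n} {x y : X.Simplex n} → x X.≈ y → map x Y.≈ map y
    natural  : ∀ {m n} (α : Mono m n) (x : X.Simplex n) →
               map (X.act α x) Y.≈ Y.act α (map x)

private
  transport-≋ : ∀ {o ℓ e n} (C : Category o ℓ e) (F : Functor (posetCategory ⟨ n ⟩) C) →
                ∀ {i j i′ j′} (p : i Fin.≤ j) (p′ : i′ Fin.≤ j′) → i ≡ i′ → j ≡ j′ →
                Category._≋_ C (Functor.F₁ F p) (Functor.F₁ F p′)
  transport-≋ C F p p′ refl refl = Category.same (Functor.F-resp-≈ F tt)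

nerve : ∀ {o ℓ e} → Category o ℓ e → SimplicialSet (o ⊔ˡ ℓ ⊔ˡ e) (o ⊔ˡ ℓ ⊔ˡ e)
nerve C = record
  { simplices = λ n → functorSetoid (posetCategory ⟨ n ⟩) C
  ; act       = λ α F → F ∘F posetFunctor α
  ; act-cong  = λ {m} {n} {α} {β} {F} {G} α≗β F≈G f →
      C.≋-trans (F≈G _) (transport-≋ C G _ _ (α≗β _) (α≗β _))
  ; act-id    = λ F _ → C.≋-refl
  ; act-∘     = λ α β F _ → C.≋-refl
  }
  where module C = Category C

nerveMap : ∀ {o ℓ e o′ ℓ′ e′} {C : Category o ℓ e} {D : Category o′ ℓ′ e′} →
           Functor C D → SimplicialMap (nerve C) (nerve D)
nerveMap {D = D} F = record
  { map      = F ∘F_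
  ; map-cong = λ x≈y f → Functor.F-resp-≋ F (x≈y f)
  ; natural  = λ _ _ _ → Category.≋-refl D
  }

------------------------------------------------------------------------
-- Topological spaces

-- Closure under arbitrary unions is expressed without a family of sets,
-- as `local`: a set which contains an open neighbourhood of each of its points
-- is open.  Open sets respect the equality of points (`respects`).
record Space (c ℓ : Level) : Set (lsuc (lsuc 0ℓ ⊔ˡ c ⊔ˡ ℓ)) where
  field
    points : Setoid c ℓ
  open Setoid points public
    renaming (refl to ≈-refl; sym to ≈-sym; trans to ≈-trans)
  field
    Open     : Pred Carrier 0ℓ → Set (lsuc 0ℓ ⊔ˡ c ⊔ˡ ℓ)
    respects : ∀ {V} → Open V → V Respects _≈_
    whole    : Open U
    inter    : ∀ {V W} → Open V → Open W → Open (V ∩ W)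
    local    : ∀ {V} → (∀ x → x ∈ V → ∃ λ W → Open W × x ∈ W × W ⊆ V) → Open V

record Base {c ℓ} (S : Setoid c ℓ) (i : Level) : Set (c ⊔ˡ ℓ ⊔ˡ lsuc (i ⊔ˡ 0ℓ)) where
  open Setoid S
  field
    Index     : Set i
    basic     : Index → Pred Carrier 0ℓ
    basic-≈   : ∀ b → basic b Respects _≈_
    basic-∈   : ∀ x → ∃ λ b → x ∈ basic b
    basic-∩   : ∀ {x} b b′ → x ∈ basic b → x ∈ basic b′ →
                ∃ λ b″ → x ∈ basic b″ × basic b″ ⊆ basic b ∩ basic b′

generatedBy : ∀ {c ℓ} {S : Setoid c ℓ} → Base S (lsuc 0ℓ ⊔ˡ c ⊔ˡ ℓ) → Space c ℓ
generatedBy {S = S} B = record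
  { points   = S
  ; Open     = λ V → ∀ x → x ∈ V → ∃ λ b → x ∈ basic b × basic b ⊆ V
  ; respects = λ V-open x≈y x∈V →
      let b , x∈b , b⊆V = V-open _ x∈V in b⊆V (basic-≈ b x≈y x∈b)
  ; whole    = λ x _ → let b , x∈b = basic-∈ x in b , x∈b , λ _ → tt
  ; inter    = λ V-open W-open x (x∈V , x∈W) →
      let b  , x∈b  , b⊆V  = V-open x x∈V
          b′ , x∈b′ , b′⊆W = W-open x x∈W
          b″ , x∈b″ , b″⊆  = basic-∩ b b′ x∈b x∈b′
      in b″ , x∈b″ , λ y∈b″ → b⊆V (proj₁ (b″⊆ y∈b″)) , b′⊆W (proj₂ (b″⊆ y∈b″))
  ; local    = λ nbhd x x∈V →
      let W , W-open , x∈W , W⊆V = nbhd x x∈V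
          b , x∈b , b⊆W = W-open x x∈W
      in b , x∈b , λ y∈b → W⊆V (b⊆W y∈b)
  }
  where open Base B

subspace : ∀ {c ℓ} (X : Space c ℓ) → Pred (Space.Carrier X) 0ℓ → Space c ℓ
subspace X P = generatedBy {S = On.setoid {B = ∃ P} X.points proj₁} record
  { Index   = ∃ X.Open
  ; basic   = λ (V , _) (x , _) → x ∈ V
  ; basic-≈ = λ (V , V-open) → X.respects V-open
  ; basic-∈ = λ _ → (U , X.whole) , tt
  ; basic-∩ = λ (V , V-open) (W , W-open) x∈V x∈W →
      (V ∩ W , X.inter V-open W-open) , (x∈V , x∈W) , id
  }
  where module X = Space X

infixr 2 _×ₛ_
_×ₛ_ : ∀ {c ℓ c′ ℓ′} → Space c ℓ → Space c′ ℓ′ → Space (c ⊔ˡ c′) (ℓ ⊔ˡ ℓ′)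
X ×ₛ Y = generatedBy {S = ×-setoid X.points Y.points} record
  { Index   = ∃ X.Open × ∃ Y.Open
  ; basic   = λ ((V , _) , (W , _)) (x , y) → x ∈ V × y ∈ W
  ; basic-≈ = λ ((_ , V-open) , (_ , W-open)) (x≈x′ , y≈y′) (x∈V , y∈W) →
      X.respects V-open x≈x′ x∈V , Y.respects W-open y≈y′ y∈W
  ; basic-∈ = λ _ → ((U , X.whole) , (U , Y.whole)) , tt , tt
  ; basic-∩ = λ ((V , oV) , (W , oW)) ((V′ , oV′) , (W′ , oW′)) (v , w) (v′ , w′) →
      ((V ∩ V′ , X.inter oV oV′) , (W ∩ W′ , Y.inter oW oW′)) ,
      ((v , v′) , (w , w′)) ,
      λ ((v , v′) , (w , w′)) → (v , w) , (v′ , w′)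
  }
  where
    module X = Space X
    module Y = Space Y

power : ∀ {c ℓ} → Space c ℓ → ℕ → Space c ℓ
power X n = generatedBy {S = ≋-setoid X.points n} record
  { Index   = Fin n → ∃ X.Open
  ; basic   = λ V x → ∀ i → x i ∈ proj₁ (V i)
  ; basic-≈ = λ V x≈y x∈V i → X.respects (proj₂ (V i)) (x≈y i) (x∈V i)
  ; basic-∈ = λ _ → (λ _ → U , X.whole) , λ _ → tt
  ; basic-∩ = λ V W x∈V x∈W →
      (λ i → proj₁ (V i) ∩ proj₁ (W i) , X.inter (proj₂ (V i)) (proj₂ (W i))) ,
      (λ i → x∈V i , x∈W i) ,
      λ y∈ → (λ i → proj₁ (y∈ i)) , (λ i → proj₂ (y∈ i))
  }
  where module X = Space X

record ContinuousMap {c ℓ c′ ℓ′} (X : Space c ℓ) (Y : Space c′ ℓ′) :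
                     Set (lsuc 0ℓ ⊔ˡ c ⊔ˡ ℓ ⊔ˡ c′ ⊔ˡ ℓ′) where
  private
    module X = Space X
    module Y = Space Y
  field
    func       : Func X.points Y.points
  open Func func public
  field
    continuous : ∀ {V} → Y.Open V → X.Open (λ x → to x ∈ V)

idMap : ∀ {c ℓ} {X : Space c ℓ} → ContinuousMap X X
idMap = record { func = record { to = id ; cong = id } ; continuous = id }

infixr 9 _∘ᶜ_
_∘ᶜ_ : ∀ {c ℓ c′ ℓ′ c″ ℓ″} {X : Space c ℓ} {Y : Space c′ ℓ′} {Z : Space c″ ℓ″} →
       ContinuousMap Y Z → ContinuousMap X Y → ContinuousMap X Z
g ∘ᶜ f = record
  { func       = record { to = g.to ∘ f.to ; cong = g.cong ∘ f.cong }
  ; continuous = λ V-open → f.continuous (g.continuous V-open)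
  }
  where
    module g = ContinuousMap g
    module f = ContinuousMap f

------------------------------------------------------------------------
-- The real line and the unit interval

-- A real number is a lower Dedekind cut; under excluded middle it determines
-- its upper half, so these are the usual (classical) real numbers.
record ℝ : Set₁ where
  field
    lower     : Pred ℚ 0ℓ
    inhabited : ∃ λ q → q ∈ lower
    proper    : ∃ λ q → ¬ q ∈ lower
    downward  : ∀ {p q} → p ℚ.≤ q → q ∈ lower → p ∈ lower
    rounded   : ∀ {p} → p ∈ lower → ∃ λ q → p ℚ.< q × q ∈ lower

open ℝ

infix 4 _≤ᴿ_ _≈ᴿ_ _<ᵠ_ _ᵠ<_

_≤ᴿ_ : ℝ → ℝ → Set
x ≤ᴿ y = lower x ⊆ lower y

_≈ᴿ_ : ℝ → ℝ → Set
x ≈ᴿ y = x ≤ᴿ y × y ≤ᴿ x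

fromℚ : ℚ → ℝ
fromℚ q = record
  { lower     = ℚ._< q
  ; inhabited = q ℚ.- 1ℚ , q-1<q
  ; proper    = q , ℚ.<-irrefl refl
  ; downward  = ℚ.≤-<-trans
  ; rounded   = λ p<q → let m , p<m , m<q = ℚ.<-dense p<q in m , p<m , m<q
  }
  where
    q-1<q : q ℚ.- 1ℚ ℚ.< q
    q-1<q = subst (q ℚ.- 1ℚ ℚ.<_) (ℚ.+-identityʳ q)
              (ℚ.+-monoʳ-< q (ℚ.negative⁻¹ (ℚ.- 1ℚ)))

0ᴿ 1ᴿ : ℝ
0ᴿ = fromℚ 0ℚ
1ᴿ = fromℚ 1ℚ

_ᵠ<_ : ℚ → ℝ → Set
p ᵠ< x = p ∈ lower x

_<ᵠ_ : ℝ → ℚ → Set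
x <ᵠ q = ∃ λ r → r ℚ.< q × ¬ r ∈ lower x

ℝ-setoid : Setoid (lsuc 0ℓ) 0ℓ
ℝ-setoid = record
  { Carrier       = ℝ
  ; _≈_           = _≈ᴿ_
  ; isEquivalence = record
    { refl  = id , id
    ; sym   = λ (p , q) → q , p
    ; trans = λ (p , q) (p′ , q′) → (λ r → p′ (p r)) , (λ r → q (q′ r))
    }
  }

-- The order topology: the open intervals with rational end points are a base.
ℝ-space : Space (lsuc 0ℓ) 0ℓ
ℝ-space = generatedBy {S = ℝ-setoid} record
  { Index   = Level.Lift (lsuc 0ℓ) (ℚ × ℚ)
  ; basic   = λ (Level.lift (p , q)) x → p ᵠ< x × x <ᵠ q
  ; basic-≈ = λ _ (x≤y , y≤x) (p<x , r , r<q , r∉x) →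
      x≤y p<x , r , r<q , λ r∈y → r∉x (y≤x r∈y)
  ; basic-∈ = λ x →
      let p , p∈x = inhabited x ; q , q∉x = proper x in
      Level.lift (p , q ℚ.+ 1ℚ) , p∈x , q , q<q+1 q , q∉x
  ; basic-∩ = λ {x} (Level.lift (p , q)) (Level.lift (p′ , q′)) (p<x , x<q) (p′<x , x<q′) →
      Level.lift (p ℚ.⊔ p′ , q ℚ.⊓ q′) ,
      ( Sum.[ (λ e → subst (_ᵠ< x) (sym e) p<x) , (λ e → subst (_ᵠ< x) (sym e) p′<x) ]′
          (ℚ.⊔-sel p p′)
      , Sum.[ (λ e → subst (x <ᵠ_) (sym e) x<q) , (λ e → subst (x <ᵠ_) (sym e) x<q′) ]′
          (ℚ.⊓-sel q q′) ) ,
      λ {y} (m<y , r , r<m , r∉y) →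
        (downward y (ℚ.p≤p⊔q p p′) m<y , r , ℚ.<-≤-trans r<m (ℚ.p⊓q≤p q q′) , r∉y) ,
        (downward y (ℚ.p≤q⊔p p p′) m<y , r , ℚ.<-≤-trans r<m (ℚ.p⊓q≤q q q′) , r∉y)
  }
  where
    q<q+1 : ∀ q → q ℚ.< q ℚ.+ 1ℚ
    q<q+1 q = subst (ℚ._< q ℚ.+ 1ℚ) (ℚ.+-identityʳ q)
                (ℚ.+-monoʳ-< q (ℚ.positive⁻¹ 1ℚ))

0≤1 : 0ᴿ ≤ᴿ 1ᴿ
0≤1 p<0 = ℚ.<-trans p<0 (ℚ.positive⁻¹ 1ℚ)

𝕀 : Space (lsuc 0ℓ) 0ℓ
𝕀 = subspace ℝ-space (λ x → 0ᴿ ≤ᴿ x × x ≤ᴿ 1ᴿ)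

𝟘 𝟙 : Space.Carrier 𝕀
𝟘 = 0ᴿ , id , 0≤1
𝟙 = 1ᴿ , 0≤1 , id

------------------------------------------------------------------------
-- Homotopy equivalences

record Homotopy {c ℓ c′ ℓ′} {X : Space c ℓ} {Y : Space c′ ℓ′}
                (f g : ContinuousMap X Y) :
                Set (lsuc 0ℓ ⊔ˡ c ⊔ˡ ℓ ⊔ˡ c′ ⊔ˡ ℓ′) where
  private
    module Y = Space Y
  open ContinuousMap
  field
    H       : ContinuousMap (X ×ₛ 𝕀) Y
    atStart : ∀ x → to H (x , 𝟘) Y.≈ to f x
    atEnd   : ∀ x → to H (x , 𝟙) Y.≈ to g x

record IsHomotopyEquivalence {c ℓ c′ ℓ′} {X : Space c ℓ} {Y : Space c′ ℓ′}
                             (f : ContinuousMap X Y) :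
                             Set (lsuc 0ℓ ⊔ˡ c ⊔ˡ ℓ ⊔ˡ c′ ⊔ˡ ℓ′) where
  field
    inverse      : ContinuousMap Y X
    leftInverse  : Homotopy (inverse ∘ᶜ f) idMap
    rightInverse : Homotopy (f ∘ᶜ inverse) idMap

infix 4 _≃_
_≃_ : ∀ {c ℓ c′ ℓ′} → Space c ℓ → Space c′ ℓ′ →
      Set (lsuc 0ℓ ⊔ˡ c ⊔ˡ ℓ ⊔ˡ c′ ⊔ˡ ℓ′)
X ≃ Y = ∃ λ (f : ContinuousMap X Y) → IsHomotopyEquivalence f

------------------------------------------------------------------------
-- Geometric realization

-- The topological n-simplex is taken in the coordinates
--   0 = t 0 ≤ t 1 ≤ … ≤ t n ≤ t (n + 1) = 1,
-- which are the partial sums  t j = u 0 + … + u (j - 1)  of the barycentric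
-- coordinates u 0, …, u n.
record IsSimplexPoint {n} (t : Vector ℝ (2+ n)) : Set where
  field
    start : t Fin.zero ≈ᴿ 0ᴿ
    end   : t (fromℕ (suc n)) ≈ᴿ 1ᴿ
    mono  : ∀ {i j} → i Fin.≤ j → t i ≤ᴿ t j

Δ : ℕ → Space (lsuc 0ℓ) 0ℓ
Δ n = subspace (power ℝ-space (2+ n)) IsSimplexPoint

-- For a monotone α : ⟨ m ⟩ → ⟨ n ⟩, the affine map Δ m → Δ n sending the i-th
-- vertex to the (α i)-th has barycentric coordinates  v k = Σ_{α i = k} u i.
-- Its j-th partial sum is thus  Σ_{α i < j} u i, and since { i | α i < j } is an
-- initial segment of ⟨ m ⟩, this is the partial sum of u of index #{ i | α i < j }.
module _ {m n : ℕ} (α : Mono m n) where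

  below? : (j : Fin (2+ n)) → Decidable (λ i → toℕ (⟦ α ⟧ i) ℕ.< toℕ j)
  below? j i = toℕ (⟦ α ⟧ i) ℕ.<? toℕ j

  #below : Fin (2+ n) → Fin (2+ m)
  #below j = fromℕ< (s≤s (count≤n (below? j) (allFin (suc m))))

private
  module _ {a p q} {A : Set a} {P : Pred A p} {Q : Pred A q}
           (P? : Decidable P) (Q? : Decidable Q) where

    count-mono : P ⊆ Q → ∀ {n} (xs : Vec A n) → count P? xs ℕ.≤ count Q? xs
    count-mono P⊆Q []       = z≤n
    count-mono P⊆Q (x ∷ xs) with P? x | Q? x
    ... | yes _ | yes _ = s≤s (count-mono P⊆Q xs)
    ... | yes p | no ¬q = ⊥-elim (¬q (P⊆Q p))
    ... | no _  | yes _ = ℕ.m≤n⇒m≤1+n (count-mono P⊆Q xs)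
    ... | no _  | no _  = count-mono P⊆Q xs

  module _ {a p} {A : Set a} {P : Pred A p} (P? : Decidable P) where

    count-none : (∀ x → ¬ P x) → ∀ {n} (xs : Vec A n) → count P? xs ≡ 0
    count-none ¬p []       = refl
    count-none ¬p (x ∷ xs) with P? x
    ... | yes p = ⊥-elim (¬p x p)
    ... | no _  = count-none ¬p xs

    count-all : (∀ x → P x) → ∀ {n} (xs : Vec A n) → count P? xs ≡ n
    count-all p []       = refl
    count-all p (x ∷ xs) with P? x
    ... | yes _ = cong suc (count-all p xs)
    ... | no ¬p = ⊥-elim (¬p (p x))

module _ {m n : ℕ} (α : Mono m n) where

  #below-start : #below α Fin.zero ≡ Fin.zero
  #below-start = Fin.toℕ-injective
    (trans (Fin.toℕ-fromℕ< _)
           (count-none (below? α Fin.zero) (λ _ ()) (allFin (suc m))))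

  #below-end : #below α (fromℕ (suc n)) ≡ fromℕ (suc m)
  #below-end = Fin.toℕ-injective
    (trans (Fin.toℕ-fromℕ< _)
    (trans (count-all (below? α (fromℕ (suc n)))
             (λ i → subst (toℕ (⟦ α ⟧ i) ℕ.<_) (sym (Fin.toℕ-fromℕ (suc n)))
                          (Fin.toℕ<n (⟦ α ⟧ i)))
             (allFin (suc m)))
           (sym (Fin.toℕ-fromℕ (suc m)))))

  #below-mono : ∀ {i j} → i Fin.≤ j → #below α i Fin.≤ #below α j
  #below-mono {i} {j} i≤j
    rewrite Fin.toℕ-fromℕ< (s≤s (count≤n (below? α i) (allFin (suc m))))
          | Fin.toℕ-fromℕ< (s≤s (count≤n (below? α j) (allFin (suc m))))
    = count-mono (below? α i) (below? α j) (λ k<i → ℕ.<-≤-trans k<i i≤j)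
                 (allFin (suc m))

  push : Space.Carrier (Δ m) → Space.Carrier (Δ n)
  push (t , t-simplex) = t ∘ #below α , record
    { start = subst (λ k → t k ≈ᴿ 0ᴿ) (sym #below-start) start
    ; end   = subst (λ k → t k ≈ᴿ 1ᴿ) (sym #below-end) end
    ; mono  = λ i≤j → mono (#below-mono i≤j)
    }
    where open IsSimplexPoint t-simplex

module _ {c ℓ} (X : SimplicialSet c ℓ) where
  private
    module X = SimplicialSet X

  RealizationPoint : Set (lsuc 0ℓ ⊔ˡ c)
  RealizationPoint = ∃ λ n → X.Simplex n × Space.Carrier (Δ n)

  -- (α* y , u) is glued to (y , α_* u).
  Glue : RealizationPoint → RealizationPoint → Set ℓ
  Glue (m , x , u) (n , y , v) =
    ∃ λ (α : Mono m n) → x X.≈ X.act α y × Space._≈_ (Δ n) (push α u) v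

  -- The quotient topology of ∐ₙ (Xₙ × Δ n), where Xₙ is discrete.
  ∣_∣ : Space (lsuc 0ℓ ⊔ˡ c) (lsuc 0ℓ ⊔ˡ c ⊔ˡ ℓ)
  ∣_∣ = record
    { points   = EqC.setoid Glue
    ; Open     = λ V → V Respects EqClosure Glue ×
                       (∀ n (x : X.Simplex n) → Space.Open (Δ n) (λ t → (n , x , t) ∈ V))
    ; respects = proj₁
    ; whole    = (λ _ _ → tt) , λ n x → Space.whole (Δ n)
    ; inter    = λ (V-resp , V-open) (W-resp , W-open) →
        (λ p (v , w) → V-resp p v , W-resp p w) ,
        λ n x → Space.inter (Δ n) (V-open n x) (W-open n x)
    ; local    = λ nbhd →
        (λ p x∈V → let W , (W-resp , _) , x∈W , W⊆V = nbhd _ x∈V in W⊆V (W-resp p x∈W)) ,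
        λ n x → Space.local (Δ n) λ t t∈V →
          let W , (_ , W-open) , t∈W , W⊆V = nbhd (n , x , t) t∈V
          in (λ t → (n , x , t) ∈ W) , W-open n x , t∈W , λ s∈W → W⊆V s∈W
    }

realizationMap : ∀ {c ℓ c′ ℓ′} {X : SimplicialSet c ℓ} {Y : SimplicialSet c′ ℓ′} →
                 SimplicialMap X Y → ContinuousMap ∣ X ∣ ∣ Y ∣
realizationMap {X = X} {Y} f = record
  { func       = record { to = to ; cong = to-cong }
  ; continuous = λ (V-resp , V-open) →
      (λ p → V-resp (to-cong p)) , λ n x → V-open n (f.map x)
  }
  where
    module f = SimplicialMap f

    to : RealizationPoint X → RealizationPoint Y
    to (n , x , t) = n , f.map x , t

    to-cong : ∀ {p q} → EqClosure (Glue X) p q → EqClosure (Glue Y) (to p) (to q)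
    to-cong = EqC.gmap to λ {(m , x , u)} {(n , y , v)} (α , x≈α*y , αu≈v) →
      α , Setoid.trans (SimplicialSet.simplices Y m) (f.map-cong x≈α*y) (f.natural α y) , αu≈v

B : ∀ {o ℓ e} → Category o ℓ e → Space (lsuc 0ℓ ⊔ˡ o ⊔ˡ ℓ ⊔ˡ e) (lsuc 0ℓ ⊔ˡ o ⊔ˡ ℓ ⊔ˡ e)
B C = ∣ nerve C ∣

B₁ : ∀ {o ℓ e o′ ℓ′ e′} {C : Category o ℓ e} {D : Category o′ ℓ′ e′} →
     Functor C D → ContinuousMap (B C) (B D)
B₁ F = realizationMap (nerveMap F)

------------------------------------------------------------------------
-- Finite sets and bijections

HasCardinality : Set → ℕ → Set
HasCardinality A n = Fin n ↔ A

Finite : Set → Set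
Finite A = ∃ (HasCardinality A)

record SetOfCardinality (n : ℕ) : Set₁ where
  field
    Carrier     : Set
    cardinality : HasCardinality Carrier n

-- The category of sets of cardinality n and bijections.  Arrows ignore the
-- chosen enumeration of the elements.
𝓢 : ℕ → Category (lsuc 0ℓ) 0ℓ 0ℓ
𝓢 n = record
  { Obj       = SetOfCardinality n
  ; _⇒_       = λ X Y → Carrier X ↔ Carrier Y
  ; _≈_       = λ f g → ∀ x → to f x ≡ to g x
  ; idn       = ↔-id _
  ; _⊙_       = _↔-∘_
  ; assoc     = λ _ _ _ _ → refl
  ; identityˡ = λ _ _ → refl
  ; identityʳ = λ _ _ → refl
  ; equiv     = record
    { refl  = λ _ → refl
    ; sym   = λ p x → sym (p x)
    ; trans = λ p q x → trans (p x) (q x)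
    }
  ; ⊙-resp-≈  = λ {_} {_} {_} {h} p q x → trans (cong (to h) (q x)) (p _)
  }
  where
    open SetOfCardinality
    open Inverse using (to)

-- π ∙ ρ is the permutation i ↦ π (ρ i).
symmetricGroup : ℕ → Group 0ℓ 0ℓ
symmetricGroup n = record
  { Carrier = Perm.Permutation′ n
  ; _≈_     = Perm._≈_
  ; _∙_     = λ π ρ → ρ Perm.∘ₚ π
  ; ε       = Perm.id
  ; _⁻¹     = Perm.flip
  ; isGroup = record
    { isMonoid = record
      { isSemigroup = record
        { isMagma = record
          { isEquivalence = record
            { refl  = λ _ → refl
            ; sym   = λ p i → sym (p i)
            ; trans = λ p q i → trans (p i) (q i)
            }
          ; ∙-cong = λ {π} p q i → trans (cong (π Perm.⟨$⟩ʳ_) (q i)) (p _)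
          }
        ; assoc = λ _ _ _ _ → refl
        }
      ; identity = (λ _ _ → refl) , (λ _ _ → refl)
      }
    ; inverse = (λ π _ → Perm.inverseˡ π) , (λ π _ → Perm.inverseʳ π)
    ; ⁻¹-cong = λ {π} {ρ} p i →
        trans (sym (Perm.inverseˡ ρ))
        (trans (cong (ρ Perm.⟨$⟩ˡ_) (sym (p (π Perm.⟨$⟩ˡ i))))
               (cong (ρ Perm.⟨$⟩ˡ_) (Perm.inverseʳ π)))
    }
  }

------------------------------------------------------------------------
-- Graphs

-- The set of half-edges is finite, and `covering` is surjective, because
-- every fibre has two elements.
record Graph : Set₁ where
  field
    Vertex          : Set
    Edge            : Set
    HalfEdge        : Set
    vertices-finite : Finite Vertex
    edges-finite    : Finite Edge
    covering        : HalfEdge → Edge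
    twoFold         : ∀ e → HasCardinality (∃ λ h → covering h ≡ e) 2
    ∂               : HalfEdge → Vertex

  -- The other element of the fibre.
  τ : HalfEdge → HalfEdge
  τ h = proj₁ (to (opposite (from (h , refl))))
    where open Inverse (twoFold (covering h))

  Element : Set
  Element = Vertex ⊎ HalfEdge

  τ⁺ : Element → Element
  τ⁺ = Sum.map id τ

  ∂⁺ : Element → Element
  ∂⁺ = [ inj₁ , inj₁ ∘ ∂ ]

  Adjacent : Vertex → Vertex → Set
  Adjacent v w = ∃ λ h → ∂ h ≡ v × ∂ (τ h) ≡ w

  -- Applied only to graphs with at least one vertex.
  Connected : Set
  Connected = ∀ v w → Star Adjacent v w

open Graph using (Element; τ⁺; ∂⁺)

record Morphism (G G′ : Graph) : Set where
  field
    map   : Element G → Element G′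
    map-τ : ∀ x → map (τ⁺ G x) ≡ τ⁺ G′ (map x)
    map-∂ : ∀ x → map (∂⁺ G x) ≡ ∂⁺ G′ (map x)

record Monomorphism (G G′ : Graph) : Set where
  field
    morphism : Morphism G G′
  open Morphism morphism public
  private
    module G  = Graph G
    module G′ = Graph G′
  field
    injective    : Injective _≡_ _≡_ map
    onVertices   : ∀ (v : G.Vertex) → ∃ λ (v′ : G′.Vertex) → map (inj₁ v) ≡ inj₁ v′
    ontoVertices : ∀ (v′ : G′.Vertex) → ∃ λ (v : G.Vertex) → map (inj₁ v) ≡ inj₁ v′
    onHalfEdges  : ∀ (h : G.HalfEdge) → ∃ λ (h′ : G′.HalfEdge) → map (inj₂ h) ≡ inj₂ h′

idMono : ∀ {G} → Monomorphism G G
idMono = record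
  { morphism     = record { map = id ; map-τ = λ _ → refl ; map-∂ = λ _ → refl }
  ; injective    = id
  ; onVertices   = λ v → v , refl
  ; ontoVertices = λ v → v , refl
  ; onHalfEdges  = λ h → h , refl
  }

infixr 9 _∘ᴹ_
_∘ᴹ_ : ∀ {G G′ G″} → Monomorphism G′ G″ → Monomorphism G G′ → Monomorphism G G″
g ∘ᴹ f = record
  { morphism     = record
    { map   = g.map ∘ f.map
    ; map-τ = λ x → trans (cong g.map (f.map-τ x)) (g.map-τ _)
    ; map-∂ = λ x → trans (cong g.map (f.map-∂ x)) (g.map-∂ _)
    }
  ; injective    = λ p → f.injective (g.injective p)
  ; onVertices   = λ v → let v′ , p = f.onVertices v ; v″ , q = g.onVertices v′ in
                         v″ , trans (cong g.map p) q
  ; ontoVertices = λ v″ → let v′ , q = g.ontoVertices v″ ; v , p = f.ontoVertices v′ in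
                          v , trans (cong g.map p) q
  ; onHalfEdges  = λ h → let h′ , p = f.onHalfEdges h ; h″ , q = g.onHalfEdges h′ in
                         h″ , trans (cong g.map p) q
  }
  where
    module g = Monomorphism g
    module f = Monomorphism f

record ConnectedGraph (r : ℕ) : Set₁ where
  field
    graph     : Graph
  open Graph graph public
  field
    order     : HasCardinality Vertex (suc r)
    connected : Connected

m𝓖 : ℕ → Category (lsuc 0ℓ) 0ℓ 0ℓ
m𝓖 r = record
  { Obj       = ConnectedGraph r
  ; _⇒_       = λ G G′ → Monomorphism (graph G) (graph G′)
  ; _≈_       = λ f g → ∀ x → map f x ≡ map g x
  ; idn       = idMono
  ; _⊙_       = _∘ᴹ_
  ; assoc     = λ _ _ _ _ → refl
  ; identityˡ = λ _ _ → refl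
  ; identityʳ = λ _ _ → refl
  ; equiv     = record
    { refl  = λ _ → refl
    ; sym   = λ p x → sym (p x)
    ; trans = λ p q x → trans (p x) (q x)
    }
  ; ⊙-resp-≈  = λ {_} {_} {_} {h} p q x → trans (cong (map h) (q x)) (p _)
  }
  where
    open ConnectedGraph using (graph)
    open Monomorphism using (map)

vertexBijection : ∀ {G G′} → Monomorphism G G′ → Graph.Vertex G ↔ Graph.Vertex G′
vertexBijection f = mk↔ₛ′
  (λ v → proj₁ (onVertices v))
  (λ v′ → proj₁ (ontoVertices v′))
  (λ v′ → inj₁-injective (trans (sym (proj₂ (onVertices _))) (proj₂ (ontoVertices v′))))
  (λ v → inj₁-injective (injective
           (trans (proj₂ (ontoVertices _)) (sym (proj₂ (onVertices v))))))
  where open Monomorphism f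

vertexFunctor : ∀ r → Functor (m𝓖 r) (𝓢 (suc r))
vertexFunctor r = record
  { F₀           = λ G → record
    { Carrier = ConnectedGraph.Vertex G ; cardinality = ConnectedGraph.order G }
  ; F₁           = vertexBijection
  ; identity     = λ _ → refl
  ; homomorphism = λ _ _ _ → refl
  ; F-resp-≈     = λ {_} {_} {f} {g} p v →
      inj₁-injective (trans (sym (proj₂ (onVertices f v)))
                     (trans (p (inj₁ v)) (proj₂ (onVertices g v))))
  }
  where open Monomorphism

{-# OPTIONS --safe #-}

-- Let K X be the complete graph on X and G ∪ K (V G) the graph obtained from G by
-- adding the edges of K (V G) to it. Both inclusions  G ↪ G ∪ K (V G) ↩ K (V G)  are
-- natural with respect to monomorphisms, because these are bijective on vertices, so
-- that K ∘ V is joined to the identity by a zigzag of natural transformations, while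
-- V ∘ K is the identity. Likewise, choosing enumerations is inverse to the inclusion of
-- the one-object category of permutations up to a natural isomorphism.
--
-- A natural transformation gives a homotopy through a map ∣ X ∣ × 𝕀 → ∣ X × Δ[1] ∣,
-- which inserts s ∈ 𝕀 into the increasing sequence of coordinates of a point of Δ n.
-- That s may be inserted at the position j is a closed condition; the maps defined on
-- these closed sets agree on the overlaps, hence define a continuous map on Δ n × 𝕀.
-- Continuity on ∣ X ∣ × 𝕀 then follows from the compactness of intervals.
module Submission where

open import Level using (Level; 0ℓ) renaming (suc to lsuc; _⊔_ to _⊔ˡ_)
open import Axiom.ExcludedMiddle using (ExcludedMiddle)
open import Data.Empty using (⊥; ⊥-elim)
open import Data.Fin.Base as Fin using (Fin; toℕ; fromℕ; fromℕ<; inject₁; pinch; punchIn; punchOut)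
open import Data.Fin.Induction using (<-weakInduction)
import Data.Fin.Properties as Fin
open import Data.Nat.Base as ℕ using (ℕ; zero; suc; 2+; z≤n; s≤s; z<s; s<s)
import Data.Nat.Properties as ℕ
open import Data.Product.Base using (∃; _×_; _,_; proj₁; proj₂)
open import Data.Product.Function.NonDependent.Propositional using (_×-↔_)
open import Data.Product.Relation.Binary.Pointwise.NonDependent using (×-setoid)
open import Data.Rational.Base as ℚ using (ℚ; 0ℚ; 1ℚ; ½)
import Data.Rational.Properties as ℚ
open import Data.Rational.Solver using (module +-*-Solver)
open import Data.Sum.Base as Sum using (_⊎_; inj₁; inj₂)
open import Data.Sum.Function.Propositional using (_⊎-↔_)
open import Data.Sum.Properties using (inj₁-injective; inj₂-injective)
open import Data.Unit.Base using (tt)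
open import Data.Vec.Base using (count; tabulate; allFin)
open import Data.Vec.Functional using (Vector; insertAt)
open import Data.Vec.Functional.Properties using (insertAt-lookup; insertAt-punchIn)
open import Data.Vec.Properties using (count≤n)
open import Function.Base using (_∘_; id; const)
open import Function.Bundles using (Inverse; _↔_; mk↔ₛ′)
open import Function.Construct.Composition using (_↔-∘_)
open import Function.Construct.Identity using (↔-id)
open import Function.Construct.Symmetry using (↔-sym)
open import Function.Definitions using (Injective)
open import Relation.Binary.Bundles using (Setoid)
open import Relation.Binary.Construct.Closure.Equivalence as EqC using (EqClosure)
open import Relation.Binary.Construct.Closure.ReflexiveTransitive using (ε; _◅_)
import Relation.Binary.Construct.On as On
open import Relation.Binary.Definitions using (Tri; tri<; tri≈; tri>)
open import Relation.Binary.Morphism.Bundles using (PosetHomomorphism; mkPosetHomo)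
open import Relation.Binary.Morphism.Construct.Composition using (posetHomomorphism)
import Relation.Binary.Morphism.Construct.Identity as Identity
open import Relation.Binary.PropositionalEquality using (_→-setoid_)
open import Relation.Binary.PropositionalEquality.Core
  using (_≡_; refl; sym; trans; cong; cong₂; subst; subst₂)
open import Relation.Nullary.Decidable.Core
  using (Dec; yes; no; map′; True; toWitness; fromWitness)
open import Relation.Nullary.Negation.Core using (¬_)
open import Relation.Unary using (Pred; _∈_; _⊆_; _∩_; U; Decidable)
open import Defs
open ContinuousMap using (to; continuous) renaming (cong to to-cong)
open ℝ using (lower; inhabited; proper; downward; rounded)
open PosetHomomorphism using (⟦_⟧) renaming (mono to ⟦⟧-mono)

-- Neither of `idF` and `complete ∘F vertexFunctor r` admits a natural transformation to the other:
-- a connected graph may have more parallel edges than the complete graph or lack some of its edges,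
-- and monomorphisms are injective on half-edges. In partial-sum coordinates a monotone map acts on
-- points of simplices by reindexing, with no addition of reals, so the geometry of the prism
-- reduces to inequalities between positions in finite linear orders. Open sets are predicates with
-- values in `Set`, whereas a condition on all points of an interval lives in `Set₁`. Excluded
-- middle at level `lsuc 0ℓ` turns such a condition into `True (em ...)`, which is in `Set` again.

private variable
  a c e ℓ o p q c′ e′ ℓ′ o′ c″ ℓ″ : Level

-- Continuous maps

module Neighbourhoods (X : Space c ℓ) where
  open Space X

  -- The level of `Q` is free, unlike that of an open set, so that conditions quantifying over
  -- points of `𝕀` are allowed.
  Near : Carrier → Pred Carrier q → Set (lsuc 0ℓ ⊔ˡ c ⊔ˡ ℓ ⊔ˡ q)
  Near x Q = ∃ λ W → Open W × x ∈ W × W ⊆ Q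

  near-open : ∀ {V x} → Open V → x ∈ V → Near x V
  near-open V-open x∈V = _ , V-open , x∈V , id

  near-mono : ∀ {x} {P : Pred Carrier p} {Q : Pred Carrier q} → P ⊆ Q → Near x P → Near x Q
  near-mono P⊆Q (W , W-open , x∈W , W⊆P) = W , W-open , x∈W , λ y∈W → P⊆Q (W⊆P y∈W)

  near-∩ : ∀ {x} {P : Pred Carrier p} {Q : Pred Carrier q} →
           Near x P → Near x Q → Near x (P ∩ Q)
  near-∩ (V , V-open , x∈V , V⊆P) (W , W-open , x∈W , W⊆Q) =
    V ∩ W , inter V-open W-open , (x∈V , x∈W) , λ (v , w) → V⊆P v , W⊆Q w

  near-∀ : ∀ {k x} (Q : Fin k → Pred Carrier q) →
           (∀ i → Near x (Q i)) → Near x (λ y → ∀ i → Q i y)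
  near-∀ {k = zero}  Q near = U , whole , tt , λ _ ()
  near-∀ {k = suc k} Q near = near-mono
    (λ { (q₀ , q) Fin.zero → q₀ ; (q₀ , q) (Fin.suc i) → q i })
    (near-∩ (near Fin.zero) (near-∀ (Q ∘ Fin.suc) (near ∘ Fin.suc)))

open Neighbourhoods

module _ (X : Space c ℓ) (Y : Space c′ ℓ′) where

  constᶜ : Space.Carrier Y → ContinuousMap X Y
  constᶜ y = record
    { func       = record { to = const y ; cong = λ _ → Space.≈-refl Y }
    ; continuous = λ _ → Space.local X λ _ y∈V → U , Space.whole X , tt , λ _ → y∈V
    }

  proj₁ᶜ : ContinuousMap (X ×ₛ Y) X
  proj₁ᶜ = record
    { func       = record { to = proj₁ ; cong = proj₁ }
    ; continuous = λ V-open _ x∈V →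
        ((_ , V-open) , (U , Space.whole Y)) , (x∈V , tt) , proj₁
    }

  proj₂ᶜ : ContinuousMap (X ×ₛ Y) Y
  proj₂ᶜ = record
    { func       = record { to = proj₂ ; cong = proj₂ }
    ; continuous = λ V-open _ y∈V →
        ((U , Space.whole X) , (_ , V-open)) , (tt , y∈V) , proj₂
    }

module _ {X : Space c ℓ} {Y : Space c′ ℓ′} {Z : Space c″ ℓ″} where

  ⟨_,_⟩ᶜ : ContinuousMap Z X → ContinuousMap Z Y → ContinuousMap Z (X ×ₛ Y)
  ⟨ f , g ⟩ᶜ = record
    { func       = record
      { to   = λ z → to f z , to g z
      ; cong = λ z≈z′ → to-cong f z≈z′ , to-cong g z≈z′
      }
    ; continuous = λ V-open → Space.local Z λ z z∈V →
        let ((A , A-open) , (B , B-open)) , (a , b) , A×B⊆V = V-open _ z∈V in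
        _ , Space.inter Z (continuous f A-open) (continuous g B-open) , (a , b) , A×B⊆V
    }

module _ (X : Space c ℓ) (P : Pred (Space.Carrier X) 0ℓ) where

  inclusion : ContinuousMap (subspace X P) X
  inclusion = record
    { func       = record { to = proj₁ ; cong = id }
    ; continuous = λ V-open _ x∈V → (_ , V-open) , x∈V , id
    }

  corestrict : {Z : Space c′ ℓ′} (f : ContinuousMap Z X) → (∀ z → to f z ∈ P) →
               ContinuousMap Z (subspace X P)
  corestrict {Z = Z} f f∈P = record
    { func       = record { to = λ z → to f z , f∈P z ; cong = to-cong f }
    ; continuous = λ V-open → Space.local Z λ z z∈V →
        let (W , W-open) , z∈W , W⊆V = V-open _ z∈V in
        _ , continuous f W-open , z∈W , W⊆V
    }

module _ (X : Space c ℓ) {n : ℕ} where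

  coordinate : Fin n → ContinuousMap (power X n) X
  coordinate k = record
    { func       = record { to = λ x → x k ; cong = λ x≈y → x≈y k }
    ; continuous = λ V-open x x∈V → box V-open , in-box V-open x x∈V , λ {y} → from-box V-open y
    }
    where
    box : ∀ {V} → Space.Open X V → Fin n → ∃ (Space.Open X)
    box V-open i with i Fin.≟ k
    ... | yes _ = _ , V-open
    ... | no  _ = U , Space.whole X

    in-box : ∀ {V} (V-open : Space.Open X V) x → x k ∈ V → ∀ i → x i ∈ proj₁ (box V-open i)
    in-box V-open x x∈V i with i Fin.≟ k
    ... | yes refl = x∈V
    ... | no  _    = tt

    from-box : ∀ {V} (V-open : Space.Open X V) x →
               (∀ i → x i ∈ proj₁ (box V-open i)) → x k ∈ V
    from-box V-open x x∈box with k Fin.≟ k | x∈box k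
    ... | yes _   | x∈V = x∈V
    ... | no  k≢k | _   = ⊥-elim (k≢k refl)

  tuple : {Z : Space c′ ℓ′} → (Fin n → ContinuousMap Z X) → ContinuousMap Z (power X n)
  tuple {Z = Z} f = record
    { func       = record { to = λ z i → to (f i) z ; cong = λ z≈z′ i → to-cong (f i) z≈z′ }
    ; continuous = λ V-open → Space.local Z λ z z∈V →
        let W , z∈W , W⊆V = V-open _ z∈V in
        near-mono Z (λ w∈ → W⊆V w∈)
          (near-∀ Z _ λ i → near-open Z (continuous (f i) (proj₂ (W i))) (z∈W i))
    }

module Paste
  (lem : {P : Set} → Dec P)
  {Z : Space c ℓ} {Y : Space c′ ℓ′} {k : ℕ}
  (C : Fin k → Pred (Space.Carrier Z) 0ℓ)
  (closed : ∀ j → Space.Open Z (λ z → ¬ C j z))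
  (cover : ∀ z → ∃ λ j → C j z)
  (f : ∀ j → ContinuousMap (subspace Z (C j)) Y)
  (agree : ∀ {z z′} i j (z∈ : C i z) (z′∈ : C j z′) → Space._≈_ Z z z′ →
           Space._≈_ Y (to (f i) (z , z∈)) (to (f j) (z′ , z′∈)))
  where

  -- Near a point, the pieces that miss it can be avoided, their complements being open, and every
  -- other piece takes the same value there. Finitely many pieces leave finitely many neighbourhoods
  -- to intersect. Since `cover` need not respect equality of points, `agree` is stated for equal
  -- points and also makes the glued function a congruence.
  paste : ContinuousMap Z Y
  paste = record
    { func       = record { to = glued ; cong = agree _ _ _ _ }
    ; continuous = λ {V} V-open → Space.local Z λ z z∈V →
        near-mono Z
          (λ {z′} near → near (proj₁ (cover z′)) (proj₂ (cover z′)))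
          (near-∀ Z (λ j z′ → (z′∈ : C j z′) → to (f j) (z′ , z′∈) ∈ V)
                  (piece V-open z z∈V))
    }
    where
    glued : Space.Carrier Z → Space.Carrier Y
    glued z = let j , z∈ = cover z in to (f j) (z , z∈)

    piece : ∀ {V} → Space.Open Y V → ∀ z → glued z ∈ V → ∀ j →
            Near Z z (λ z′ → (z′∈ : C j z′) → to (f j) (z′ , z′∈) ∈ V)
    piece V-open z z∈V j with lem {C j z}
    ... | no  z∉ = near-mono Z (λ z′∉ z′∈ → ⊥-elim (z′∉ z′∈)) (near-open Z (closed j) z∉)
    ... | yes z∈ =
      let (W , W-open) , z∈W , W⊆V = continuous (f j) V-open (z , z∈)
            (Space.respects Y V-open (agree _ j _ z∈ (Space.≈-refl Z)) z∈V)
      in W , W-open , z∈W , λ z′∈W z′∈ → W⊆V {_ , z′∈} z′∈W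

  paste-≈ : ∀ j {z} (z∈ : C j z) → Space._≈_ Y (to paste z) (to (f j) (z , z∈))
  paste-≈ j z∈ = agree _ j _ z∈ (Space.≈-refl Z)

-- The real line

module ≈ᴿ = Setoid ℝ-setoid

q<q+1 : ∀ q → q ℚ.< q ℚ.+ 1ℚ
q<q+1 q = subst (ℚ._< q ℚ.+ 1ℚ) (ℚ.+-identityʳ q) (ℚ.+-monoʳ-< q (ℚ.positive⁻¹ 1ℚ))

ᵠ<-open : ∀ p → Space.Open ℝ-space (p ᵠ<_)
ᵠ<-open p x p<x =
  let q , q∉x = proper x in
  Level.lift (p , q ℚ.+ 1ℚ) , (p<x , q , q<q+1 q , q∉x) , proj₁

<ᵠ-open : ∀ q → Space.Open ℝ-space (_<ᵠ q)
<ᵠ-open q x x<q = let p , p∈x = inhabited x in Level.lift (p , q) , (p∈x , x<q) , proj₂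

ᵠ<⇒≤ᴿ : ∀ {q} x → q ᵠ< x → fromℚ q ≤ᴿ x
ᵠ<⇒≤ᴿ x q<x p<q = downward x (ℚ.<⇒≤ p<q) q<x

∉⇒≤ᴿ : ∀ {q} x → ¬ q ∈ lower x → x ≤ᴿ fromℚ q
∉⇒≤ᴿ x q∉x {p} p∈x = ℚ.≰⇒> λ q≤p → q∉x (downward x q≤p p∈x)

<ᵠ⇒≤ᴿ : ∀ {q} x → x <ᵠ q → x ≤ᴿ fromℚ q
<ᵠ⇒≤ᴿ x (r , r<q , r∉x) p∈x = ℚ.<-trans (∉⇒≤ᴿ x r∉x p∈x) r<q

≤ᴿ⇒<ᵠ : ∀ {p q} x → x ≤ᴿ fromℚ p → p ℚ.< q → x <ᵠ q
≤ᴿ⇒<ᵠ {p} x x≤p p<q = p , p<q , λ p∈x → ℚ.<-irrefl refl (x≤p p∈x)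

fromℚ-mono : ∀ {p q} → p ℚ.≤ q → fromℚ p ≤ᴿ fromℚ q
fromℚ-mono p≤q r<p = ℚ.<-≤-trans r<p p≤q

fromℚ-cancel-≤ : ∀ {p q} → fromℚ p ≤ᴿ fromℚ q → p ℚ.≤ q
fromℚ-cancel-≤ p≤q = ℚ.≮⇒≥ λ q<p → ℚ.<-irrefl refl (p≤q q<p)

module Order (lem : {P : Set} → Dec P) where

  ≰⇒separated : ∀ x y → ¬ x ≤ᴿ y → ∃ λ q → q ᵠ< x × ¬ q ᵠ< y
  ≰⇒separated x y x≰y with lem {∃ λ q → q ᵠ< x × ¬ q ᵠ< y}
  ... | yes separated = separated
  ... | no  ¬separated = ⊥-elim (x≰y λ {q} q∈x → in-y q q∈x lem)
    where
    in-y : ∀ q → q ᵠ< x → Dec (q ᵠ< y) → q ᵠ< y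
    in-y q _   (yes q∈y) = q∈y
    in-y q q∈x (no  q∉y) = ⊥-elim (¬separated (q , q∈x , q∉y))

  ≰⇒≥ : ∀ x y → ¬ x ≤ᴿ y → y ≤ᴿ x
  ≰⇒≥ x y x≰y r∈y =
    let q , q∈x , q∉y = ≰⇒separated x y x≰y in
    downward x (ℚ.<⇒≤ (∉⇒≤ᴿ y q∉y r∈y)) q∈x

  -- Between `to g z` and `to f z` lie two rationals `q` and `q′`. Exceeding `q′` is an open
  -- condition on `f`, being below `q′` one on `g`, and together they exclude `f ≤ g`. The second
  -- rational is there because `_<ᵠ_` wants a missed rational strictly below its bound.
  ≰-open : {Z : Space c ℓ} (f g : ContinuousMap Z ℝ-space) →
           Space.Open Z (λ z → ¬ to f z ≤ᴿ to g z)
  ≰-open {Z = Z} f g = Space.local Z λ z f≰g →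
    let q , q∈f , q∉g = ≰⇒separated (to f z) (to g z) f≰g
        q′ , q<q′ , q′∈f = rounded (to f z) q∈f
    in near-mono Z
         (λ {z′} (q′<f , r , r<q′ , r∉g) f≤g →
           r∉g (downward (to g z′) (ℚ.<⇒≤ r<q′) (f≤g q′<f)))
         (near-∩ Z (near-open Z (continuous f (ᵠ<-open q′)) q′∈f)
                   (near-open Z (continuous g (<ᵠ-open q′)) (q , q<q′ , q∉g)))

  locate : ∀ {n} (t : Vector ℝ (2+ n)) s → t Fin.zero ≤ᴿ s → s ≤ᴿ t (fromℕ (suc n)) →
           ∃ λ (j : Fin (suc n)) → t (Fin.inject₁ j) ≤ᴿ s × s ≤ᴿ t (Fin.suc j)
  locate {zero}  t s t≤s s≤t = Fin.zero , t≤s , s≤t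
  locate {suc n} t s t≤s s≤t with lem {t (Fin.suc Fin.zero) ≤ᴿ s}
  ... | yes t₁≤s = let j , below , above = locate (t ∘ Fin.suc) s t₁≤s s≤t in
                   Fin.suc j , below , above
  ... | no  t₁≰s = Fin.zero , t≤s , ≰⇒≥ (t (Fin.suc Fin.zero)) s t₁≰s

-- For an increasing bijection φ of ℚ, the increasing bijection of ℝ that extends
-- the inverse of φ.
module Extension
  (φ ψ : ℚ → ℚ) (φ-mono : ∀ {p q} → p ℚ.< q → φ p ℚ.< φ q)
  (ψ-mono : ∀ {p q} → p ℚ.< q → ψ p ℚ.< ψ q)
  (φψ : ∀ q → φ (ψ q) ≡ q) (ψφ : ∀ q → ψ (φ q) ≡ q)
  where

  φ-mono-≤ : ∀ {p q} → p ℚ.≤ q → φ p ℚ.≤ φ q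
  φ-mono-≤ p≤q = ℚ.≮⇒≥ λ φq<φp →
    ℚ.<-irrefl refl (ℚ.<-≤-trans (subst₂ ℚ._<_ (ψφ _) (ψφ _) (ψ-mono φq<φp)) p≤q)

  extend : ℝ → ℝ
  extend x = record
    { lower     = λ q → φ q ∈ lower x
    ; inhabited = let q , q∈x = inhabited x in ψ q , subst (_∈ lower x) (sym (φψ q)) q∈x
    ; proper    = let q , q∉x = proper x in ψ q , q∉x ∘ subst (_∈ lower x) (φψ q)
    ; downward  = downward x ∘ φ-mono-≤
    ; rounded   = λ φp∈x → let q , φp<q , q∈x = rounded x φp∈x in
        ψ q , subst (ℚ._< ψ q) (ψφ _) (ψ-mono φp<q) , subst (_∈ lower x) (sym (φψ q)) q∈x
    }

  extend-fromℚ : ∀ q → extend (fromℚ (φ q)) ≈ᴿ fromℚ q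
  extend-fromℚ q = (λ φp<φq → subst₂ ℚ._<_ (ψφ _) (ψφ _) (ψ-mono φp<φq)) , φ-mono

  extendᶜ : ContinuousMap ℝ-space ℝ-space
  extendᶜ = record
    { func       = record { to = extend ; cong = λ (x≤y , y≤x) → (λ q∈ → x≤y q∈) , (λ q∈ → y≤x q∈) }
    ; continuous = λ V-open x x∈V →
        let Level.lift (p , q) , (p<x , r , r<q , r∉x) , pq⊆V = V-open (extend x) x∈V in
        Level.lift (φ p , φ q) , (p<x , φ r , φ-mono r<q , r∉x) ,
        λ { {y} (p<y , s , s<φq , s∉y) → pq⊆V
              ( p<y , ψ s , subst (ψ s ℚ.<_) (ψφ q) (ψ-mono s<φq)
              , s∉y ∘ subst (_∈ lower y) (φψ s)) }
    }

module Reflection (lem : {P : Set} → Dec P) where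

  1-_ : ℚ → ℚ
  1- q = 1ℚ ℚ.- q

  1-1- : ∀ q → 1- (1- q) ≡ q
  1-1- = solve 1 (λ q → con 1ℚ :- (con 1ℚ :- q) := q) refl
    where open +-*-Solver

  1-antimono-< : ∀ {p q} → p ℚ.< q → 1- q ℚ.< 1- p
  1-antimono-< p<q = ℚ.+-monoʳ-< 1ℚ (ℚ.neg-antimono-< p<q)

  1-antimono-≤ : ∀ {p q} → p ℚ.≤ q → 1- q ℚ.≤ 1- p
  1-antimono-≤ p≤q = ℚ.+-monoʳ-≤ 1ℚ (ℚ.neg-antimono-≤ p≤q)

  ¬<ᵠ⇒ᵠ< : ∀ {q r} x → q ℚ.< r → ¬ x <ᵠ r → q ᵠ< x
  ¬<ᵠ⇒ᵠ< {q} {r} x q<r x≮r with lem {q ᵠ< x}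
  ... | yes q<x = q<x
  ... | no  q≮x = ⊥-elim (x≮r (q , q<r , q≮x))

  <ᵠ-asym : ∀ {q} x → q ᵠ< x → ¬ x <ᵠ q
  <ᵠ-asym x q<x (r , r<q , r∉x) = r∉x (downward x (ℚ.<⇒≤ r<q) q<x)

  -- The real number 1 - x. Requiring only that `1- q` lie outside the cut of `x` would not give a
  -- rounded cut for rational `x`; hence the strict `_<ᵠ_`.
  reflect : ℝ → ℝ
  reflect x = record
    { lower     = λ q → x <ᵠ 1- q
    ; inhabited = let q , q∉x = proper x in
        1- (q ℚ.+ 1ℚ) , q , subst (q ℚ.<_) (sym (1-1- _)) (q<q+1 q) , q∉x
    ; proper    = let q , q∈x = inhabited x in
        1- q , λ x< → <ᵠ-asym x q∈x (subst (x <ᵠ_) (1-1- q) x<)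
    ; downward  = λ p≤q (r , r<1-q , r∉x) → r , ℚ.<-≤-trans r<1-q (1-antimono-≤ p≤q) , r∉x
    ; rounded   = λ (r , r<1-p , r∉x) →
        let m , r<m , m<1-p = ℚ.<-dense r<1-p in
        1- m , subst (ℚ._< 1- m) (1-1- _) (1-antimono-< m<1-p) ,
        r , subst (r ℚ.<_) (sym (1-1- m)) r<m , r∉x
    }

  reflect-antimono : ∀ {x y} → x ≤ᴿ y → reflect y ≤ᴿ reflect x
  reflect-antimono x≤y (r , r< , r∉y) = r , r< , λ r∈x → r∉y (x≤y r∈x)

  reflect-fromℚ : ∀ q → reflect (fromℚ q) ≈ᴿ fromℚ (1- q)
  reflect-fromℚ q =
    (λ (r , r<1-p , r≮q) →
      subst (ℚ._< 1- q) (1-1- _) (1-antimono-< (ℚ.≤-<-trans (ℚ.≮⇒≥ r≮q) r<1-p))) ,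
    λ p<1-q → q , subst (ℚ._< _) (1-1- q) (1-antimono-< p<1-q) , ℚ.<-irrefl refl

  reflectᶜ : ContinuousMap ℝ-space ℝ-space
  reflectᶜ = record
    { func       = record
      { to = reflect
      ; cong = λ {x} {y} (x≤y , y≤x) →
          (λ {q} → reflect-antimono {y} {x} y≤x {q}) ,
          (λ {q} → reflect-antimono {x} {y} x≤y {q})
      }
    ; continuous = λ V-open x x∈V →
        let Level.lift (p , q) , (x<1-p , r , r<q , x≮1-r) , pq⊆V = V-open (reflect x) x∈V
        in Level.lift (1- q , 1- p) , (¬<ᵠ⇒ᵠ< x (1-antimono-< r<q) x≮1-r , x<1-p) ,
           λ {y} (1-q<y , y<1-p) →
             let m , 1-q<m , m∈y = rounded y 1-q<y in
             pq⊆V {reflect y} ( y<1-p , 1- m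
                  , subst (1- m ℚ.<_) (1-1- q) (1-antimono-< 1-q<m)
                  , λ y<m → <ᵠ-asym y m∈y (subst (y <ᵠ_) (1-1- m) y<m))
    }

-- Homotopies

2ℚ : ℚ
2ℚ = 1ℚ ℚ.+ 1ℚ

module _ where
  open +-*-Solver

  private
    ½*2* : ∀ q → ½ ℚ.* (2ℚ ℚ.* q) ≡ q
    ½*2* = solve 1 (λ q → con ½ :* (con 2ℚ :* q) := q) refl

    2*½* : ∀ q → 2ℚ ℚ.* (½ ℚ.* q) ≡ q
    2*½* = solve 1 (λ q → con 2ℚ :* (con ½ :* q) := q) refl

    ½*1+[2*-1] : ∀ q → ½ ℚ.* (1ℚ ℚ.+ (2ℚ ℚ.* q ℚ.- 1ℚ)) ≡ q
    ½*1+[2*-1] = solve 1 (λ q → con ½ :* (con 1ℚ :+ (con 2ℚ :* q :- con 1ℚ)) := q) refl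

    2*½*1+-1 : ∀ q → 2ℚ ℚ.* (½ ℚ.* (1ℚ ℚ.+ q)) ℚ.- 1ℚ ≡ q
    2*½*1+-1 = solve 1 (λ q → con 2ℚ :* (con ½ :* (con 1ℚ :+ q)) :- con 1ℚ := q) refl

  -- The maps s ↦ 2 s and s ↦ 2 s - 1.
  module FirstHalf = Extension (½ ℚ.*_) (2ℚ ℚ.*_)
    (ℚ.*-monoʳ-<-pos ½) (ℚ.*-monoʳ-<-pos 2ℚ) ½*2* 2*½*

  module SecondHalf = Extension (λ q → ½ ℚ.* (1ℚ ℚ.+ q)) (λ q → 2ℚ ℚ.* q ℚ.- 1ℚ)
    (λ p<q → ℚ.*-monoʳ-<-pos ½ (ℚ.+-monoʳ-< 1ℚ p<q))
    (λ p<q → ℚ.+-monoˡ-< (ℚ.- 1ℚ) (ℚ.*-monoʳ-<-pos 2ℚ p<q)) ½*1+[2*-1] 2*½*1+-1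

½ᴿ : ℝ
½ᴿ = fromℚ ½

module _ {X : Space c ℓ} {Y : Space c′ ℓ′} where
  open Homotopy

  homotopy-resp-≗ : {f f′ g g′ : ContinuousMap X Y} →
    (∀ x → Space._≈_ Y (to f x) (to f′ x)) → (∀ x → Space._≈_ Y (to g x) (to g′ x)) →
    Homotopy f g → Homotopy f′ g′
  homotopy-resp-≗ f≗f′ g≗g′ h = record
    { H       = H h
    ; atStart = λ x → Space.≈-trans Y (atStart h x) (f≗f′ x)
    ; atEnd   = λ x → Space.≈-trans Y (atEnd h x) (g≗g′ x)
    }

  homotopy-refl : {f : ContinuousMap X Y} → Homotopy f f
  homotopy-refl {f} = record
    { H       = f ∘ᶜ proj₁ᶜ X 𝕀
    ; atStart = λ _ → Space.≈-refl Y
    ; atEnd   = λ _ → Space.≈-refl Y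
    }

  module _ (lem : {P : Set} → Dec P) where
    open Reflection lem
    open Order lem

    private
      Z : Space _ _
      Z = X ×ₛ 𝕀

      parameter : ContinuousMap Z ℝ-space
      parameter = inclusion ℝ-space _ ∘ᶜ proj₂ᶜ X 𝕀

    homotopy-sym : {f g : ContinuousMap X Y} → Homotopy f g → Homotopy g f
    homotopy-sym h = record
      { H       = H h ∘ᶜ reversed
      ; atStart = λ x → Space.≈-trans Y
          (to-cong (H h) (Space.≈-refl X , reflect-fromℚ 0ℚ)) (atEnd h x)
      ; atEnd   = λ x → Space.≈-trans Y
          (to-cong (H h) (Space.≈-refl X , reflect-fromℚ 1ℚ)) (atStart h x)
      }
      where
      bounds : ∀ ((_ , s , _) : Space.Carrier (X ×ₛ 𝕀)) → 0ᴿ ≤ᴿ reflect s × reflect s ≤ᴿ 1ᴿ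
      bounds (_ , s , 0≤s , s≤1) =
        (λ {q} q<0 → reflect-antimono {s} {1ᴿ} s≤1 {q} (proj₂ (reflect-fromℚ 1ℚ) {q} q<0)) ,
        (λ {q} q∈ → proj₁ (reflect-fromℚ 0ℚ) {q} (reflect-antimono {0ᴿ} {s} 0≤s {q} q∈))

      reversed : ContinuousMap Z Z
      reversed = ⟨ proj₁ᶜ X 𝕀 , corestrict ℝ-space _ (reflectᶜ ∘ᶜ parameter) bounds ⟩ᶜ

    homotopy-trans : {f g h : ContinuousMap X Y} → Homotopy f g → Homotopy g h → Homotopy f h
    homotopy-trans {f} {g} {h} F G = record
      { H       = paste
      ; atStart = λ x → Space.≈-trans Y
          (paste-≈ Fin.zero {x , 𝟘} (fromℚ-mono (ℚ.nonNegative⁻¹ ½)))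
          (Space.≈-trans Y
            (to-cong (H F) (Space.≈-refl X , FirstHalf.extend-fromℚ 0ℚ)) (atStart F x))
      ; atEnd   = λ x → Space.≈-trans Y
          (paste-≈ (Fin.suc Fin.zero) {x , 𝟙} (fromℚ-mono ½≤1))
          (Space.≈-trans Y
            (to-cong (H G) (Space.≈-refl X , SecondHalf.extend-fromℚ 1ℚ)) (atEnd G x))
      }
      where
      ½≤1 : ½ ℚ.≤ 1ℚ
      ½≤1 = subst (ℚ._≤ 1ℚ) (ℚ.+-identityʳ ½) (ℚ.+-monoʳ-≤ ½ (ℚ.nonNegative⁻¹ ½))

      half : Fin 2 → Pred (Space.Carrier Z) 0ℓ
      half Fin.zero            (_ , s , _) = s ≤ᴿ ½ᴿ
      half (Fin.suc Fin.zero)  (_ , s , _) = ½ᴿ ≤ᴿ s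

      closed : ∀ i → Space.Open Z (λ z → ¬ half i z)
      closed Fin.zero           = ≰-open parameter (constᶜ Z ℝ-space ½ᴿ)
      closed (Fin.suc Fin.zero) = ≰-open (constᶜ Z ℝ-space ½ᴿ) parameter

      cover : ∀ z → ∃ λ i → half i z
      cover (_ , s , _) with lem {s ≤ᴿ ½ᴿ}
      ... | yes s≤½ = Fin.zero , s≤½
      ... | no  s≰½ = Fin.suc Fin.zero , ≰⇒≥ s ½ᴿ s≰½

      first : ContinuousMap (subspace Z (half Fin.zero)) (X ×ₛ 𝕀)
      first = ⟨ proj₁ᶜ X 𝕀 ∘ᶜ inclusion Z _
              , corestrict ℝ-space _ (FirstHalf.extendᶜ ∘ᶜ parameter ∘ᶜ inclusion Z _)
                  (λ ((_ , s , 0≤s , _) , s≤½) →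
                    (λ q<0 → 0≤s (proj₂ (FirstHalf.extend-fromℚ 0ℚ) q<0)) ,
                    (λ q∈ → proj₁ (FirstHalf.extend-fromℚ 1ℚ) (s≤½ q∈))) ⟩ᶜ

      second : ContinuousMap (subspace Z (half (Fin.suc Fin.zero))) (X ×ₛ 𝕀)
      second = ⟨ proj₁ᶜ X 𝕀 ∘ᶜ inclusion Z _
               , corestrict ℝ-space _ (SecondHalf.extendᶜ ∘ᶜ parameter ∘ᶜ inclusion Z _)
                   (λ ((_ , s , _ , s≤1) , ½≤s) →
                     (λ q<0 → ½≤s (proj₂ (SecondHalf.extend-fromℚ 0ℚ) q<0)) ,
                     (λ q∈ → proj₁ (SecondHalf.extend-fromℚ 1ℚ) (s≤1 q∈))) ⟩ᶜ

      piece : ∀ i → ContinuousMap (subspace Z (half i)) Y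
      piece Fin.zero           = H F ∘ᶜ first
      piece (Fin.suc Fin.zero) = H G ∘ᶜ second

      -- On the overlap the parameter is ½, which `first` sends to 1 and `second` to 0; both values
      -- are then those of `g`.
      meet : ∀ {z z′} (z∈ : half Fin.zero z) (z′∈ : half (Fin.suc Fin.zero) z′) →
             Space._≈_ Z z z′ →
             Space._≈_ Y (to (H F ∘ᶜ first) (z , z∈)) (to (H G ∘ᶜ second) (z′ , z′∈))
      meet {x , s , _} {x′ , s′ , _} s≤½ ½≤s′ (x≈x′ , s≤s′ , s′≤s) =
        Space.≈-trans Y
          (to-cong (H F) (x≈x′ , (λ q∈ → proj₁ (FirstHalf.extend-fromℚ 1ℚ) (s≤½ q∈)) ,
                                 (λ q∈ → s′≤s (½≤s′ (proj₂ (FirstHalf.extend-fromℚ 1ℚ) q∈)))))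
        (Space.≈-trans Y (atEnd F x′)
        (Space.≈-trans Y (Space.≈-sym Y (atStart G x′))
          (to-cong (H G) (Space.≈-refl X ,
            (λ q∈ → ½≤s′ (proj₂ (SecondHalf.extend-fromℚ 0ℚ) q∈)) ,
            (λ q∈ → proj₁ (SecondHalf.extend-fromℚ 0ℚ) (s≤½ (s′≤s q∈)))))))

      agree : ∀ {z z′} i j (z∈ : half i z) (z′∈ : half j z′) → Space._≈_ Z z z′ →
              Space._≈_ Y (to (piece i) (z , z∈)) (to (piece j) (z′ , z′∈))
      agree {z} {z′} Fin.zero Fin.zero z∈ z′∈ z≈z′ =
        to-cong (piece Fin.zero) {z , z∈} {z′ , z′∈} z≈z′
      agree {z} {z′} Fin.zero (Fin.suc Fin.zero) z∈ z′∈ z≈z′ = meet {z} {z′} z∈ z′∈ z≈z′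
      agree {z} {z′} (Fin.suc Fin.zero) Fin.zero z∈ z′∈ z≈z′ =
        Space.≈-sym Y (meet {z′} {z} z′∈ z∈ (Space.≈-sym Z {z} {z′} z≈z′))
      agree {z} {z′} (Fin.suc Fin.zero) (Fin.suc Fin.zero) z∈ z′∈ z≈z′ =
        to-cong (piece (Fin.suc Fin.zero)) {z , z∈} {z′ , z′∈} z≈z′

      open Paste lem {Z = Z} {Y = Y} half closed cover piece (λ {z} {z′} → agree {z} {z′})

-- The product of a realization with the unit interval

module _ (em : ExcludedMiddle (lsuc 0ℓ)) where

  lem : {P : Set} → Dec P
  lem = map′ Level.lower Level.lift em

  open Order lem

  Between : ℚ → ℚ → Pred (Space.Carrier 𝕀) 0ℓ
  Between a b (s , _) = fromℚ a ≤ᴿ s × s ≤ᴿ fromℚ b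

  -- Compactness of [a , b] ∩ 𝕀 enters through the supremum of the d for which
  -- there is a tube around [a , d] ∩ 𝕀.
  module Tube (Y : Space (lsuc 0ℓ) 0ℓ) {O : Pred (Space.Carrier (Y ×ₛ 𝕀)) 0ℓ}
              (O-open : Space.Open (Y ×ₛ 𝕀) O) where

    Slab : ℚ → ℚ → Pred (Space.Carrier Y) (lsuc 0ℓ)
    Slab a b y = ∀ s → Between a b s → (y , s) ∈ O

    module _ {a b y} (slab : y ∈ Slab a b) (¬tube : ¬ Near Y y (Slab a b)) where
      private
        Tubular : ℚ → Set (lsuc 0ℓ)
        Tubular d = Near Y y (Slab a d)

        tubular-vacuous : ∀ {d} → (∀ s → ¬ Between a d s) → Tubular d
        tubular-vacuous empty = U , Space.whole Y , tt , λ _ s between → ⊥-elim (empty s between)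

        tubular-<a : ∀ {d} → d ℚ.< a → Tubular d
        tubular-<a {d} d<a = tubular-vacuous λ s (a≤s , s≤d) →
          ℚ.<-irrefl refl (ℚ.<-≤-trans d<a (fromℚ-cancel-≤ λ r<a → s≤d (a≤s r<a)))

        tubular-<0 : ∀ {d} → d ℚ.< 0ℚ → Tubular d
        tubular-<0 {d} d<0 = tubular-vacuous λ (s , 0≤s , _) (_ , s≤d) →
          ℚ.<-irrefl refl (ℚ.<-≤-trans d<0 (fromℚ-cancel-≤ λ r<0 → s≤d (0≤s r<0)))

        tubular⇒<b : ∀ {d} → Tubular d → d ℚ.< b
        tubular⇒<b tubular = ℚ.≰⇒> λ b≤d → ¬tube
          (near-mono Y (λ slab s (a≤s , s≤b) →
            slab s (a≤s , λ r∈s → fromℚ-mono b≤d (s≤b r∈s))) tubular)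

        tubular⇒<1 : ∀ {d} → Tubular d → d ℚ.< 1ℚ
        tubular⇒<1 tubular = ℚ.≰⇒> λ 1≤d → ¬tube
          (near-mono Y (λ { slab s@(_ , _ , s≤1) (a≤s , _) →
            slab s (a≤s , λ r∈s → fromℚ-mono 1≤d (s≤1 r∈s)) }) tubular)

        -- The strict inequality makes the cut rounded, and `True` brings the condition down to
        -- `Set`, where `lower` takes its values.
        TubularAbove : ℚ → Set
        TubularAbove q = True (em {∃ λ d → q ℚ.< d × Tubular d})

        above : ∀ {q d} → q ℚ.< d → Tubular d → TubularAbove q
        above q<d tubular = fromWitness (_ , q<d , tubular)

        supremum : ℝ
        supremum = record
          { lower     = TubularAbove
          ; inhabited = let q<a = subst (a ℚ.- 1ℚ ℚ.<_) (ℚ.+-identityʳ a)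
                              (ℚ.+-monoʳ-< a (ℚ.negative⁻¹ (ℚ.- 1ℚ)))
                            m , q<m , m<a = ℚ.<-dense q<a
                        in a ℚ.- 1ℚ , above q<m (tubular-<a m<a)
          ; proper    = b , λ b∈ → let d , b<d , tubular = toWitness b∈ in
                              ℚ.<-asym b<d (tubular⇒<b tubular)
          ; downward  = λ p≤q q∈ → let d , q<d , tubular = toWitness q∈ in
                              above (ℚ.≤-<-trans p≤q q<d) tubular
          ; rounded   = λ p∈ → let d , p<d , tubular = toWitness p∈
                                   m , p<m , m<d = ℚ.<-dense p<d
                               in m , p<m , above m<d tubular
          }

        supremum∈𝕀 : Space.Carrier 𝕀
        supremum∈𝕀 = supremum ,
          (λ q<0 → let m , q<m , m<0 = ℚ.<-dense q<0 in above q<m (tubular-<0 m<0)) ,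
          (λ q∈ → let d , q<d , tubular = toWitness q∈ in ℚ.<-trans q<d (tubular⇒<1 tubular))

        between : Between a b supremum∈𝕀
        between =
          (λ q<a → let m , q<m , m<a = ℚ.<-dense q<a in above q<m (tubular-<a m<a)) ,
          (λ q∈ → let d , q<d , tubular = toWitness q∈ in ℚ.<-trans q<d (tubular⇒<b tubular))

      -- The slab contains the point over the supremum, so an open box around that point lies in
      -- `O`. A tube reaching beyond the lower end of the box, combined with the box, gives a tube
      -- reaching beyond the supremum.
      no-supremum : ⊥
      no-supremum =
        let ((N , N-open) , (W , W-open)) , (y∈N , σ∈W) , N×W⊆O =
              O-open (y , supremum∈𝕀) (slab supremum∈𝕀 between)
            (V , V-open) , σ∈V , V⊆W = W-open supremum∈𝕀 σ∈W
            Level.lift (p , q) , (p<σ , r , r<q , r∉σ) , pq⊆V = V-open supremum σ∈V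
            d , p<d , tubular-d = toWitness p<σ
            -- Since `r` is not below the supremum, a tube up to any `m > r` is a contradiction;
            -- `m < q` keeps the extension inside the box.
            m , r<m , m<q = ℚ.<-dense r<q
            tubular-m : Tubular m
            tubular-m = near-mono Y
              (λ { {y′} (y′∈N , slab-d) s@(t , _) (a≤t , t≤m) →
                -- Parameters up to `d` are covered by the old tube; those in `(d , m]` lie between
                -- `p` and `q`, hence in the box.
                case-≤ s (lem {t ≤ᴿ fromℚ d})
                  (λ t≤d → slab-d s (a≤t , t≤d))
                  (λ t≰d → N×W⊆O {y′ , s} (y′∈N , V⊆W {s} (pq⊆V {t}
                    ( (let u , u∈t , u≮d = ≰⇒separated t (fromℚ d) t≰d in
                       downward t (ℚ.<⇒≤ (ℚ.<-≤-trans p<d (ℚ.≮⇒≥ u≮d))) u∈t)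
                    , ≤ᴿ⇒<ᵠ t t≤m m<q)))) })
              (near-∩ Y (near-open Y N-open y∈N) tubular-d)
        in r∉σ (above r<m tubular-m)
        where
        case-≤ : ∀ {y′ : Space.Carrier Y} s {P : Set} → Dec P →
                 (P → (y′ , s) ∈ O) → (¬ P → (y′ , s) ∈ O) → (y′ , s) ∈ O
        case-≤ s (yes p) f g = f p
        case-≤ s (no ¬p) f g = g ¬p

    near-slab : ∀ {a b y} → y ∈ Slab a b → Near Y y (Slab a b)
    near-slab {a} {b} {y} slab with em {Near Y y (Slab a b)}
    ... | yes near  = near
    ... | no  ¬near = ⊥-elim (no-supremum slab ¬near)

    slab-open : ∀ a b → Space.Open Y (λ y → True (em {Slab a b y}))
    slab-open a b = Space.local Y λ y slab →
      near-mono Y (λ {y′} slab′ → fromWitness {a? = em {Slab a b y′}} slab′)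
        (near-slab (toWitness slab))

  -- The product with 𝕀 of a realization again has the quotient topology.
  module _ (X : SimplicialSet c ℓ) (Y : Space c′ ℓ′)
           (f : ∀ {n} → SimplicialSet.Simplex X n → ContinuousMap (Δ n ×ₛ 𝕀) Y)
           (glue : ∀ {m n x y u v} → Glue X (m , x , u) (n , y , v) → ∀ s →
                   Space._≈_ Y (to (f x) (u , s)) (to (f y) (v , s))) where

    fromRealization×𝕀 : ContinuousMap (∣ X ∣ ×ₛ 𝕀) Y
    fromRealization×𝕀 = record
      { func       = record
        { to   = F
        ; cong = λ {(p , s)} {(q , s′)} (p≈q , s≈s′) →
            Space.≈-trans Y (F-resp s p≈q)
              (to-cong (f (proj₁ (proj₂ q)))
                {proj₂ (proj₂ q) , s} {proj₂ (proj₂ q) , s′}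
                (Space.≈-refl (Δ (proj₁ q)) {proj₂ (proj₂ q)} , s≈s′))
        }
      ; continuous = F-continuous
      }
      where
      F : Space.Carrier (∣ X ∣ ×ₛ 𝕀) → Space.Carrier Y
      F ((n , x , u) , s) = to (f x) (u , s)

      F-resp : ∀ s {p q} → EqClosure (Glue X) p q → Space._≈_ Y (F (p , s)) (F (q , s))
      F-resp s = EqC.gfold (Space.isEquivalence Y) (λ p → F (p , s)) (λ g → glue g s)

      F-continuous : ∀ {V} → Space.Open Y V → Space.Open (∣ X ∣ ×ₛ 𝕀) (λ z → F z ∈ V)
      F-continuous {V} V-open ((n , x , u) , s@(t , _)) s∈V =
        let (_ , (W , W-open)) , (u∈N , s∈W) , N×W⊆V = continuous (f x) V-open (u , s) s∈V
            (V′ , V′-open) , t∈V′ , V′⊆W = W-open s s∈W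
            Level.lift (p , q) , (p<t , r , r<q , r∉t) , pq⊆V′ = V′-open t t∈V′
            -- The closed interval from `a` to `b` lies inside `(p , q)`, while its interior still
            -- contains `t`. The tube argument is applied to the closed interval and the product
            -- neighbourhood is taken over the open one.
            a , p<a , a∈t = rounded t p<t
            b , r<b , b<q = ℚ.<-dense r<q
            -- All points whose whole slab over the interval lands in `V`. Unlike `N`, which lives
            -- on one simplex, this set is saturated under gluing, because `F` respects it, and it
            -- is open on every simplex by `slab-open`.
            A = λ z → True (em {∀ s → Between a b s → F (z , s) ∈ V})
            A-resp = λ {z} {z′} (z≈z′ : EqClosure (Glue X) z z′) (z∈A : z ∈ A) →
              fromWitness {a? = em {∀ s → Between a b s → F (z′ , s) ∈ V}}
                λ s between → Space.respects Y V-open (F-resp s z≈z′) (toWitness z∈A s between)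
            I-open = Space.inter 𝕀 (continuous (inclusion ℝ-space _) (ᵠ<-open a))
                                   (continuous (inclusion ℝ-space _) (<ᵠ-open b))
        in ( (A , (λ {z} {z′} → A-resp {z} {z′})
                , λ n x → Tube.slab-open (Δ n) {λ z → to (f x) z ∈ V} (continuous (f x) V-open) a b)
           , (_ , I-open)) ,
           ( fromWitness (λ { s′@(t′ , _) (a≤t′ , t′≤b) →
               N×W⊆V {u , s′} (u∈N , V′⊆W {s′} (pq⊆V′ {t′} (a≤t′ p<a , ≤ᴿ⇒<ᵠ t′ t′≤b b<q))) })
           , a∈t , r , r<b , r∉t ) ,
           λ { {(z , s′@(t′ , _))} (z∈A , a<t′ , t′<b) →
             toWitness z∈A s′ (ᵠ<⇒≤ᴿ t′ a<t′ , <ᵠ⇒≤ᴿ t′ t′<b) }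

-- Monotone maps and affine maps of simplices

module _ {A : Set a} {P : Pred A p} (P? : Decidable P) where

  count-empty : ∀ {n} (f : Fin n → A) → (∀ i → ¬ P (f i)) → count P? (tabulate f) ≡ 0
  count-empty {zero}  f ¬p = refl
  count-empty {suc n} f ¬p with P? (f Fin.zero)
  ... | yes p₀ = ⊥-elim (¬p Fin.zero p₀)
  ... | no  _  = count-empty (f ∘ Fin.suc) (¬p ∘ Fin.suc)

  -- For a downward closed predicate the indices that satisfy it form an initial segment, and the
  -- count is its length. A general `f` makes the induction pass to `f ∘ Fin.suc`.
  <count⇒ : ∀ {n} (f : Fin n → A) → (∀ {i j} → i Fin.≤ j → P (f j) → P (f i)) →
            ∀ i → toℕ i ℕ.< count P? (tabulate f) → P (f i)
  <count⇒ {suc n} f down i i< with P? (f Fin.zero)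
  <count⇒ {suc n} f down Fin.zero    i<       | yes p₀ = p₀
  <count⇒ {suc n} f down (Fin.suc i) (s≤s i<) | yes p₀ =
    <count⇒ (f ∘ Fin.suc) (λ {i} {j} i≤j → down {Fin.suc i} {Fin.suc j} (s≤s i≤j)) i i<
  <count⇒ {suc n} f down i i< | no ¬p₀
    with () ← subst (toℕ i ℕ.<_)
                (count-empty (f ∘ Fin.suc) (λ j pⱼ → ¬p₀ (down {Fin.zero} {Fin.suc j} z≤n pⱼ))) i<

  <count⇐ : ∀ {n} (f : Fin n → A) → (∀ {i j} → i Fin.≤ j → P (f j) → P (f i)) →
            ∀ i → P (f i) → toℕ i ℕ.< count P? (tabulate f)
  <count⇐ {suc n} f down i pᵢ with P? (f Fin.zero)
  <count⇐ {suc n} f down Fin.zero    pᵢ | yes _ = z<s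
  <count⇐ {suc n} f down (Fin.suc i) pᵢ | yes _ =
    s<s (<count⇐ (f ∘ Fin.suc) (λ {i} {j} i≤j → down {Fin.suc i} {Fin.suc j} (s≤s i≤j)) i pᵢ)
  ... | no ¬p₀ = ⊥-elim (¬p₀ (down {Fin.zero} {i} z≤n pᵢ))

-- As a map of linear orders, #below α is adjoint to α.
module _ {m n : ℕ} (α : Mono m n) where

  private
    toℕ-#below : ∀ (k : Fin (2+ n)) → toℕ (#below α k) ≡ count (below? α k) (allFin (suc m))
    toℕ-#below k = Fin.toℕ-fromℕ< (s≤s (count≤n (below? α k) (allFin (suc m))))

    down : ∀ (k : Fin (2+ n)) {i j} → i Fin.≤ j → toℕ (⟦ α ⟧ j) ℕ.< toℕ k → toℕ (⟦ α ⟧ i) ℕ.< toℕ k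
    down k i≤j = ℕ.≤-<-trans (⟦⟧-mono α i≤j)

  <#below⇒ : ∀ {i} {k : Fin (2+ n)} → toℕ i ℕ.< toℕ (#below α k) → toℕ (⟦ α ⟧ i) ℕ.< toℕ k
  <#below⇒ {i} {k} i< =
    <count⇒ (below? α k) id (down k) i (subst (toℕ i ℕ.<_) (toℕ-#below k) i<)

  <#below⇐ : ∀ {i} {k : Fin (2+ n)} → toℕ (⟦ α ⟧ i) ℕ.< toℕ k → toℕ i ℕ.< toℕ (#below α k)
  <#below⇐ {i} {k} αi<k =
    subst (toℕ i ℕ.<_) (sym (toℕ-#below k)) (<count⇐ (below? α k) id (down k) i αi<k)

-- A position `c` is identified with the initial segment of elements before it. If `d < c`, then `d`
-- itself is an element, because `c` is at most m + 1, and it lies before `c` but not before `d`.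
≤-by-elements : ∀ {m} {c d : Fin (2+ m)} →
                (∀ (i : Fin (suc m)) → toℕ i ℕ.< toℕ c → toℕ i ℕ.< toℕ d) → c Fin.≤ d
≤-by-elements {m} {c} {d} c⊆d = ℕ.≮⇒≥ λ d<c →
  let d<m+1 = ℕ.<-≤-trans d<c (Fin.toℕ≤pred[n] c)
      d≡    = Fin.toℕ-fromℕ< d<m+1
  in ℕ.<-irrefl d≡ (c⊆d (fromℕ< d<m+1) (subst (ℕ._< toℕ c) (sym d≡) d<c))

-- Uniqueness of adjoints; the later computations of `#below` rest on it instead of counting.
#below-unique : ∀ {m n} (α : Mono m n) {k c} →
  (∀ i → toℕ i ℕ.< toℕ c → toℕ (⟦ α ⟧ i) ℕ.< toℕ k) →
  (∀ i → toℕ (⟦ α ⟧ i) ℕ.< toℕ k → toℕ i ℕ.< toℕ c) → #below α k ≡ c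
#below-unique α c⇒ c⇐ = Fin.≤-antisym
  (≤-by-elements λ i i< → c⇐ i (<#below⇒ α i<))
  (≤-by-elements λ i i< → <#below⇐ α (c⇒ i i<))

#below-id : ∀ {n} k → #below (Identity.posetHomomorphism ⟨ n ⟩) k ≡ k
#below-id k = #below-unique (Identity.posetHomomorphism ⟨ _ ⟩) (λ _ → id) (λ _ → id)

#below-factor : ∀ {l m n} (γ : Mono l m) (σ : Mono m n) (β : Mono l n) →
                (∀ i → ⟦ σ ⟧ (⟦ γ ⟧ i) ≡ ⟦ β ⟧ i) →
                ∀ k → #below γ (#below σ k) ≡ #below β k
#below-factor γ σ β σγ≗β k = sym (#below-unique β
  (λ i i< → subst (λ j → toℕ j ℕ.< toℕ k) (σγ≗β i) (<#below⇒ σ (<#below⇒ γ i<)))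
  (λ i βi<k → <#below⇐ γ (<#below⇐ σ (subst (λ j → toℕ j ℕ.< toℕ k) (sym (σγ≗β i)) βi<k))))

degeneracy : ∀ {n} → Fin (suc n) → Mono (suc n) n
degeneracy j = mkPosetHomo ⟨ _ ⟩ ⟨ _ ⟩ (pinch j) (Fin.pinch-mono-≤ j)

-- The position of the coordinate which is forgotten by `push (degeneracy j)`.
slot : ∀ {n} → Fin (suc n) → Fin (2+ (suc n))
slot j = Fin.suc (inject₁ j)

pinch-inject₁ : ∀ {n} (j b : Fin n) → b Fin.≤ j → pinch j (inject₁ b) ≡ b
pinch-inject₁ j           Fin.zero    _         = refl
pinch-inject₁ (Fin.suc j) (Fin.suc b) (s≤s b≤j) = cong Fin.suc (pinch-inject₁ j b b≤j)

pinch-suc : ∀ {n} (j b : Fin n) → j Fin.≤ b → pinch j (Fin.suc b) ≡ b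
pinch-suc Fin.zero    b           _         = refl
pinch-suc (Fin.suc j) (Fin.suc b) (s≤s j≤b) = cong Fin.suc (pinch-suc j b j≤b)

<slot⇒pinch≤ : ∀ {n} (j : Fin (suc n)) i → toℕ i ℕ.< toℕ (slot j) → pinch j i Fin.≤ j
<slot⇒pinch≤ j i (s≤s i≤j) =
  subst (pinch j i Fin.≤_) (pinch-inject₁ j j ℕ.≤-refl) (Fin.pinch-mono-≤ j i≤j)

slot≤⇒≤pinch : ∀ {n} (j : Fin (suc n)) i → slot j Fin.≤ i → j Fin.≤ pinch j i
slot≤⇒≤pinch j i j<i =
  subst (Fin._≤ pinch j i) (pinch-suc j j ℕ.≤-refl)
    (Fin.pinch-mono-≤ j {Fin.suc j} {i} (subst (λ k → suc k ℕ.≤ toℕ i) (Fin.toℕ-inject₁ j) j<i))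

-- With the converse below, this is the adjunction that identifies `punchIn (slot j)` with
-- `#below (degeneracy j)`.
<punchIn⇒pinch< : ∀ {n} (j : Fin (suc n)) i k →
  toℕ i ℕ.< toℕ (punchIn (slot j) k) → toℕ (pinch j i) ℕ.< toℕ k
<punchIn⇒pinch< j           Fin.zero    (Fin.suc k) _        = z<s
<punchIn⇒pinch< Fin.zero    (Fin.suc i) (Fin.suc k) (s<s i<) = i<
<punchIn⇒pinch< {suc n} (Fin.suc j) (Fin.suc i) (Fin.suc k) (s<s i<) =
  s<s (<punchIn⇒pinch< j i k i<)

pinch<⇒<punchIn : ∀ {n} (j : Fin (suc n)) i k →
  toℕ (pinch j i) ℕ.< toℕ k → toℕ i ℕ.< toℕ (punchIn (slot j) k)
pinch<⇒<punchIn j           Fin.zero    (Fin.suc k) _        = z<s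
pinch<⇒<punchIn Fin.zero    (Fin.suc i) (Fin.suc k) i<       = s<s i<
pinch<⇒<punchIn {suc n} (Fin.suc j) (Fin.suc i) (Fin.suc k) (s<s i<) =
  s<s (pinch<⇒<punchIn j i k i<)

#below-degeneracy : ∀ {n} (j : Fin (suc n)) k → #below (degeneracy j) k ≡ punchIn (slot j) k
#below-degeneracy j k = #below-unique (degeneracy j)
  (λ i → <punchIn⇒pinch< j i k) (λ i → pinch<⇒<punchIn j i k)

-- Every monotone map to `⟨ 1 ⟩` has this form for exactly one `c`, so that the n-simplices of the
-- simplicial interval correspond to the coordinates of a point of `Δ n`.
threshold : ∀ {n} → Fin (2+ n) → Mono n 1
threshold {n} c = mkPosetHomo ⟨ n ⟩ ⟨ 1 ⟩ bit bit-mono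
  where
  bit : Fin (suc n) → Fin 2
  bit i with toℕ i ℕ.<? toℕ c
  ... | yes _ = Fin.zero
  ... | no  _ = Fin.suc Fin.zero

  bit-mono : ∀ {i j} → i Fin.≤ j → bit i Fin.≤ bit j
  bit-mono {i} {j} i≤j with toℕ i ℕ.<? toℕ c | toℕ j ℕ.<? toℕ c
  ... | yes _  | _      = z≤n
  ... | no _   | no _   = s≤s z≤n
  ... | no i≮c | yes j<c = ⊥-elim (i≮c (ℕ.≤-<-trans i≤j j<c))

module _ {n : ℕ} (c : Fin (2+ n)) {i : Fin (suc n)} where

  threshold-< : toℕ i ℕ.< toℕ c → ⟦ threshold c ⟧ i ≡ Fin.zero
  threshold-< i<c with toℕ i ℕ.<? toℕ c
  ... | yes _   = refl
  ... | no  i≮c = ⊥-elim (i≮c i<c)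

  threshold-≥ : c Fin.≤ i → ⟦ threshold c ⟧ i ≡ Fin.suc Fin.zero
  threshold-≥ c≤i with toℕ i ℕ.<? toℕ c
  ... | yes i<c = ⊥-elim (ℕ.<⇒≱ i<c c≤i)
  ... | no  _   = refl

  threshold≡0⇒< : ⟦ threshold c ⟧ i ≡ Fin.zero → toℕ i ℕ.< toℕ c
  threshold≡0⇒< bit≡0 with toℕ i ℕ.<? toℕ c
  threshold≡0⇒< _  | yes i<c = i<c
  threshold≡0⇒< () | no  _

  threshold≡1⇒≥ : ⟦ threshold c ⟧ i ≡ Fin.suc Fin.zero → c Fin.≤ i
  threshold≡1⇒≥ bit≡1 with toℕ i ℕ.<? toℕ c
  threshold≡1⇒≥ () | yes _
  threshold≡1⇒≥ _  | no i≮c = ℕ.≮⇒≥ i≮c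

-- The index of the only inner coordinate of a point of `Δ 1`, which is its parameter in the unit
-- interval.
one : Fin 3
one = Fin.suc Fin.zero

≡0⇔<one : ∀ {b : Fin 2} →
          (b ≡ Fin.zero → toℕ b ℕ.< toℕ one) × (toℕ b ℕ.< toℕ one → b ≡ Fin.zero)
≡0⇔<one = (λ { refl → z<s }) , λ { b<1 → Fin.toℕ-injective (ℕ.n<1⇒n≡0 b<1) }

#below-threshold : ∀ {n} (c : Fin (2+ n)) → #below (threshold c) one ≡ c
#below-threshold c = #below-unique (threshold c)
  (λ i i<c → proj₁ ≡0⇔<one (threshold-< c i<c))
  (λ i bit<1 → threshold≡0⇒< c (proj₂ ≡0⇔<one bit<1))

-- The decomposition of the prism

Prism : ℕ → Space (lsuc 0ℓ) 0ℓ
Prism n = Δ n ×ₛ 𝕀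

-- The members of the standard decomposition of the prism into n + 1 simplices.
Slice : ∀ {n} → Fin (suc n) → Pred (Space.Carrier (Prism n)) 0ℓ
Slice j ((t , _) , s , _) = t (inject₁ j) ≤ᴿ s × s ≤ᴿ t (Fin.suc j)

module _ {n : ℕ} where

  baseᶜ : Fin (2+ n) → ContinuousMap (Prism n) ℝ-space
  baseᶜ k = coordinate ℝ-space k ∘ᶜ inclusion (power ℝ-space (2+ n)) IsSimplexPoint ∘ᶜ
            proj₁ᶜ (Δ n) 𝕀

  parameterᶜ : ContinuousMap (Prism n) ℝ-space
  parameterᶜ = inclusion ℝ-space _ ∘ᶜ proj₂ᶜ (Δ n) 𝕀

module _ {n : ℕ} (j : Fin (suc n)) where

  -- Inserting among continuous maps rather than among reals makes every coordinate continuous by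
  -- construction.
  insertᶜ : Fin (2+ (suc n)) → ContinuousMap (Prism n) ℝ-space
  insertᶜ = insertAt baseᶜ (slot j) parameterᶜ

  insert : Space.Carrier (Prism n) → Vector ℝ (2+ (suc n))
  insert z k = to (insertᶜ k) z

  insert-slot : ∀ z → insert z (slot j) ≡ proj₁ (proj₂ z)
  insert-slot z = cong (λ f → to f z) (insertAt-lookup baseᶜ (slot j) parameterᶜ)

  insert-punchIn : ∀ z k → insert z (punchIn (slot j) k) ≡ proj₁ (proj₁ z) k
  insert-punchIn z k = cong (λ f → to f z) (insertAt-punchIn baseᶜ (slot j) parameterᶜ k)

  insert-#below : ∀ z k → insert z (#below (degeneracy j) k) ≡ proj₁ (proj₁ z) k
  insert-#below z k = trans (cong (insert z) (#below-degeneracy j k)) (insert-punchIn z k)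

  data SlotView : Fin (2+ (suc n)) → Set where
    slotted : SlotView (slot j)
    punched : ∀ k → SlotView (punchIn (slot j) k)

  slotView : ∀ k → SlotView k
  slotView k with slot j Fin.≟ k
  ... | yes refl = slotted
  ... | no  j≢k  = subst SlotView (Fin.punchIn-punchOut j≢k) (punched (punchOut j≢k))

  insert-isSimplexPoint : ∀ z → z ∈ Slice j → IsSimplexPoint (insert z)
  insert-isSimplexPoint z@((t , t-simplex) , s , _) (t≤s , s≤t) = record
    -- `#below (degeneracy j)` fixes both extreme positions, so the end coordinates are still those
    -- of `t`.
    { start = subst (_≈ᴿ 0ᴿ)
        (trans (sym (insert-#below z Fin.zero))
               (cong (insert z) (#below-start (degeneracy j)))) start
    ; end   = subst (_≈ᴿ 1ᴿ)
        (trans (sym (insert-#below z (fromℕ (suc n))))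
               (cong (insert z) (#below-end (degeneracy j)))) end
    ; mono  = λ {k} {l} → insert-mono (slotView k) (slotView l)
    }
    where
    open IsSimplexPoint t-simplex

    insert-mono : ∀ {k l} → SlotView k → SlotView l → k Fin.≤ l → insert z k ≤ᴿ insert z l
    insert-mono slotted slotted _ q∈ = q∈
    insert-mono slotted (punched l) j≤l q∈ =
      subst (λ x → _ ∈ lower x) (sym (insert-punchIn z l))
        (mono {Fin.suc j} {l} j<l (s≤t (subst (λ x → _ ∈ lower x) (insert-slot z) q∈)))
      where
      j<l : toℕ j ℕ.< toℕ l
      j<l = subst (λ i → toℕ i ℕ.< toℕ l) (pinch-inject₁ j j ℕ.≤-refl)
              (<punchIn⇒pinch< j (inject₁ j) l j≤l)
    insert-mono (punched k) slotted k≤j q∈ =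
      subst (λ x → _ ∈ lower x) (sym (insert-slot z))
        (t≤s (mono {k} {inject₁ j} (ℕ.≮⇒≥ k≯j) (subst (λ x → _ ∈ lower x) (insert-punchIn z k) q∈)))
      where
      k≯j : ¬ toℕ (inject₁ j) ℕ.< toℕ k
      k≯j j<k = ℕ.<⇒≱
        (pinch<⇒<punchIn j (Fin.suc j) k
          (subst (ℕ._< toℕ k)
            (trans (Fin.toℕ-inject₁ j) (cong toℕ (sym (pinch-suc j j ℕ.≤-refl)))) j<k))
        (subst (toℕ (punchIn (slot j) k) ℕ.≤_) (cong suc (Fin.toℕ-inject₁ j)) k≤j)
    insert-mono (punched k) (punched l) k≤l q∈ =
      subst (λ x → _ ∈ lower x) (sym (insert-punchIn z l))
        (mono (Fin.punchIn-cancel-≤ (slot j) k l k≤l)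
          (subst (λ x → _ ∈ lower x) (insert-punchIn z k) q∈))

  simplexOfSlice : ∀ {z} → z ∈ Slice j → Space.Carrier (Δ (suc n))
  simplexOfSlice {z} z∈ = insert z , insert-isSimplexPoint z z∈

  simplexOfSliceᶜ : ContinuousMap (subspace (Prism n) (Slice j)) (Δ (suc n))
  simplexOfSliceᶜ = corestrict (power ℝ-space (2+ (suc n))) IsSimplexPoint
    (tuple ℝ-space (λ k → insertᶜ k ∘ᶜ inclusion (Prism n) (Slice j)))
    (λ (z , z∈) → insert-isSimplexPoint z z∈)

-- A pair β, ν is a simplex of ⟨ n ⟩ × ⟨ 1 ⟩; it fits j when it lies in the simplex
-- whose vertices are (0 , 0), …, (j , 0), (j , 1), …, (n , 1).
Fits : ∀ {N n} → Fin (suc n) → Mono N n → Mono N 1 → Set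
Fits j β ν = ∀ i → (⟦ ν ⟧ i ≡ Fin.zero → ⟦ β ⟧ i Fin.≤ j) ×
                   (⟦ ν ⟧ i ≡ Fin.suc Fin.zero → j Fin.≤ ⟦ β ⟧ i)

record IsLift {N n} (β : Mono N n) (ν : Mono N 1)
              (w : Space.Carrier (Δ N)) (z : Space.Carrier (Prism n)) : Set where
  field
    base      : Space._≈_ (Δ n) (push β w) (proj₁ z)
    parameter : proj₁ w (#below ν one) ≈ᴿ proj₁ (proj₂ z)

module _ {N n : ℕ} {j : Fin (suc n)} (β : Mono N n) (ν : Mono N 1) (fits : Fits j β ν) where

  private
    -- The position of the vertex `(k , b)` in the list of vertices of a slice. It is the same for
    -- every slice that contains the vertex.
    combine : Fin 2 → Fin (suc n) → Fin (2+ n)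
    combine Fin.zero           k = inject₁ k
    combine (Fin.suc Fin.zero) k = Fin.suc k

    combine-mono : ∀ {b b′ k k′} → b Fin.≤ b′ → k Fin.≤ k′ → combine b k Fin.≤ combine b′ k′
    combine-mono {Fin.zero} {Fin.zero} {k} {k′} _ k≤k′ =
      subst₂ ℕ._≤_ (sym (Fin.toℕ-inject₁ k)) (sym (Fin.toℕ-inject₁ k′)) k≤k′
    combine-mono {Fin.zero} {Fin.suc Fin.zero} {k} _ k≤k′ =
      subst (ℕ._≤ _) (sym (Fin.toℕ-inject₁ k)) (ℕ.m≤n⇒m≤1+n k≤k′)
    combine-mono {Fin.suc Fin.zero} {Fin.suc Fin.zero} _ k≤k′ = s≤s k≤k′

  factorization : Mono N (suc n)
  factorization = mkPosetHomo ⟨ N ⟩ ⟨ suc n ⟩ (λ i → combine (⟦ ν ⟧ i) (⟦ β ⟧ i))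
    (λ i≤i′ → combine-mono (⟦⟧-mono ν i≤i′) (⟦⟧-mono β i≤i′))

  degeneracy-factorization : ∀ i → ⟦ degeneracy j ⟧ (⟦ factorization ⟧ i) ≡ ⟦ β ⟧ i
  degeneracy-factorization i with ⟦ ν ⟧ i | fits i
  ... | Fin.zero         | below , _ = pinch-inject₁ j _ (below refl)
  ... | Fin.suc Fin.zero | _ , above = pinch-suc j _ (above refl)

  threshold-factorization : ∀ i → ⟦ threshold (slot j) ⟧ (⟦ factorization ⟧ i) ≡ ⟦ ν ⟧ i
  threshold-factorization i with ⟦ ν ⟧ i | fits i
  ... | Fin.zero         | below , _ = threshold-< (slot j)
    (s≤s (subst₂ ℕ._≤_ (sym (Fin.toℕ-inject₁ _)) (sym (Fin.toℕ-inject₁ j)) (below refl)))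
  ... | Fin.suc Fin.zero | _ , above = threshold-≥ (slot j)
    (s≤s (subst (ℕ._≤ _) (sym (Fin.toℕ-inject₁ j)) (above refl)))

  module _ {w z} (lift : IsLift β ν w z) where
    open IsLift lift
    open IsSimplexPoint (proj₂ w)

    -- `Fits` places the cut of `ν` between the cuts of `β` at `inject₁ j` and at `Fin.suc j`, and
    -- the coordinates of `w` are increasing.
    lift∈slice : z ∈ Slice j
    lift∈slice =
      (λ q∈ → proj₁ parameter (mono below (proj₂ (base (inject₁ j)) q∈))) ,
      (λ q∈ → proj₁ (base (Fin.suc j)) (mono above (proj₂ parameter q∈)))
      where
      below : #below β (inject₁ j) Fin.≤ #below ν one
      below = ≤-by-elements λ i i< → <#below⇐ ν (small (⟦ ν ⟧ i) refl (<#below⇒ β i<))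
        where
        small : ∀ {i} b → ⟦ ν ⟧ i ≡ b → toℕ (⟦ β ⟧ i) ℕ.< toℕ (inject₁ j) → toℕ (⟦ ν ⟧ i) ℕ.< 1
        small Fin.zero ν≡0 _ = proj₁ ≡0⇔<one ν≡0
        small {i} (Fin.suc Fin.zero) ν≡1 β<j = ⊥-elim
          (ℕ.<⇒≱ (subst (toℕ (⟦ β ⟧ i) ℕ.<_) (Fin.toℕ-inject₁ j) β<j) (proj₂ (fits i) ν≡1))

      above : #below ν one Fin.≤ #below β (Fin.suc j)
      above = ≤-by-elements λ i i< →
        <#below⇐ β (s≤s (proj₁ (fits i) (proj₂ ≡0⇔<one (<#below⇒ ν i<))))

    -- The threshold reads off the slot of a point of `Δ (suc n)` and the degeneracy all other
    -- coordinates; the composites of both with the factorization are `ν` and `β`.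
    push-factorization : (z∈ : z ∈ Slice j) →
      Space._≈_ (Δ (suc n)) (push factorization w) (simplexOfSlice j {z} z∈)
    push-factorization z∈ k = at (slotView j k)
      where
      at : ∀ {k} → SlotView j k → proj₁ w (#below factorization k) ≈ᴿ insert j z k
      at slotted = subst₂ (λ l x → proj₁ w l ≈ᴿ x)
        (trans (sym (#below-factor factorization (threshold (slot j)) ν
                       threshold-factorization one))
               (cong (#below factorization) (#below-threshold (slot j))))
        (sym (insert-slot j z)) parameter
      at (punched k) = subst₂ (λ l x → proj₁ w l ≈ᴿ x)
        (trans (sym (#below-factor factorization (degeneracy j) β degeneracy-factorization k))
               (cong (#below factorization) (#below-degeneracy j k)))
        (sym (insert-punchIn j z k)) (base k)

insert-isLift : ∀ {n} (j : Fin (suc n)) {z} (z∈ : z ∈ Slice j) →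
                IsLift (degeneracy j) (threshold (slot j)) (simplexOfSlice j {z} z∈) z
insert-isLift j {z} z∈ = record
  { base      = λ k → ≈ᴿ.reflexive (insert-#below j z k)
  ; parameter = ≈ᴿ.reflexive
      (trans (cong (insert j z) (#below-threshold (slot j))) (insert-slot j z))
  }

-- The cylinder of a simplicial set

identity : ∀ n → Mono n n
identity n = Identity.posetHomomorphism ⟨ n ⟩

constant : ∀ {n} → Fin 2 → Mono n 1
constant b = mkPosetHomo ⟨ _ ⟩ ⟨ 1 ⟩ (const b) (λ _ → ℕ.≤-refl)

cylinder : SimplicialSet c ℓ → SimplicialSet c ℓ
cylinder X = record
  { simplices = λ n → ×-setoid (X.simplices n)
                               (On.setoid {B = Mono n 1} (Fin (suc n) →-setoid Fin 2) ⟦_⟧)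
  ; act       = λ α (x , ν) → X.act α x , posetHomomorphism α ν
  ; act-cong  = λ {m} {n} {α} {β} {(_ , ν)} α≗β (x≈y , ν≗μ) →
      X.act-cong α≗β x≈y , λ i → trans (cong ⟦ ν ⟧ (α≗β i)) (ν≗μ (⟦ β ⟧ i))
  ; act-id    = λ (x , _) → X.act-id x , λ _ → refl
  ; act-∘     = λ α β (x , _) → X.act-∘ α β x , λ _ → refl
  }
  where module X = SimplicialSet X

module _ (X : SimplicialSet c ℓ) where
  private module X = SimplicialSet X

  simplexᶜ : ∀ {n} → X.Simplex n → ContinuousMap (Δ n) ∣ X ∣
  simplexᶜ {n} x = record
    { func       = record
      { to   = λ t → n , x , t
      ; cong = λ {t} {t′} t≈t′ → EqC.return
          ( identity n , Setoid.sym (X.simplices n) (X.act-id x)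
          , λ k → subst (λ l → proj₁ t l ≈ᴿ proj₁ t′ k) (sym (#below-id k)) (t≈t′ k))
      }
    ; continuous = λ (_ , V-open) → V-open n x
    }

  glue-≈ : ∀ {n} {x y : X.Simplex n} t → x X.≈ y → EqClosure (Glue X) (n , x , t) (n , y , t)
  glue-≈ {n} {x} {y} t x≈y = EqC.return
    ( identity n , Setoid.trans (X.simplices n) x≈y (Setoid.sym (X.simplices n) (X.act-id y))
    , λ k → ≈ᴿ.reflexive (cong (proj₁ t) (#below-id k)))

module _ (X : SimplicialSet c ℓ) where
  private
    module X = SimplicialSet X
    Cyl = cylinder X
    module ∣Cyl∣ = Space ∣ Cyl ∣

  sliceᶜ : ∀ {n} → X.Simplex n → (j : Fin (suc n)) →
           ContinuousMap (subspace (Prism n) (Slice j)) ∣ Cyl ∣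
  sliceᶜ x j =
    simplexᶜ Cyl (X.act (degeneracy j) x , threshold (slot j)) ∘ᶜ simplexOfSliceᶜ j

  module _ {N n} {j : Fin (suc n)} (β : Mono N n) (ν : Mono N 1) (fits : Fits j β ν)
           {x′ x} (x′≈β*x : x′ X.≈ X.act β x) {w z} (lift : IsLift β ν w z) where

    -- The factorization is itself the gluing map: it pulls the simplex of the slice back to
    -- `(x′ , ν)` and pushes `w` forward to the point of that slice over `z`.
    lift-≈-slice : (z∈ : z ∈ Slice j) → (N , (x′ , ν) , w) ∣Cyl∣.≈ to (sliceᶜ x j) (z , z∈)
    lift-≈-slice z∈ = EqC.return
      ( factorization β ν fits
      , ( x≈.trans x′≈β*x (x≈.trans
            (X.act-cong (λ i → sym (degeneracy-factorization β ν fits i)) x≈.refl)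
            (X.act-∘ (factorization β ν fits) (degeneracy j) x))
        , λ i → sym (threshold-factorization β ν fits i))
      , push-factorization β ν fits {w} {z} lift z∈ )
      where module x≈ {n} = Setoid (X.simplices n)

  module _ {n} (t : Space.Carrier (Δ n)) (s : Space.Carrier 𝕀) where
    open IsSimplexPoint (proj₂ t)

    threshold-isLift : ∀ c → proj₁ t c ≈ᴿ proj₁ s →
                       IsLift (identity n) (threshold c) t (t , s)
    threshold-isLift c tc≈s = record
      { base      = λ k → ≈ᴿ.reflexive (cong (proj₁ t) (#below-id k))
      ; parameter = subst (λ k → proj₁ t k ≈ᴿ proj₁ s) (sym (#below-threshold c)) tc≈s
      }

    fits-suc : ∀ (j : Fin (suc n)) → Fits j (identity n) (threshold (Fin.suc j))
    fits-suc j i = (λ ν≡0 → ℕ.s≤s⁻¹ (threshold≡0⇒< (Fin.suc j) ν≡0)) ,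
                   (λ ν≡1 → ℕ.<⇒≤ (threshold≡1⇒≥ (Fin.suc j) ν≡1))

    fits-inject₁ : ∀ (j : Fin (suc n)) → Fits j (identity n) (threshold (inject₁ j))
    fits-inject₁ j i =
      (λ ν≡0 → ℕ.<⇒≤ (subst (toℕ i ℕ.<_) (Fin.toℕ-inject₁ j) (threshold≡0⇒< (inject₁ j) ν≡0))) ,
      (λ ν≡1 → subst (ℕ._≤ toℕ i) (Fin.toℕ-inject₁ j) (threshold≡1⇒≥ (inject₁ j) ν≡1))

    module _ (x : X.Simplex n) where
      private
        atThreshold : Fin (2+ n) → ∣Cyl∣.Carrier
        atThreshold c = n , (x , threshold c) , t

        x≈id*x : x X.≈ X.act (identity n) x
        x≈id*x = Setoid.sym (X.simplices n) (X.act-id x)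

      threshold-≈-slice-suc : ∀ j (z∈ : (t , s) ∈ Slice j) → proj₁ t (Fin.suc j) ≈ᴿ proj₁ s →
        atThreshold (Fin.suc j) ∣Cyl∣.≈ to (sliceᶜ x j) ((t , s) , z∈)
      threshold-≈-slice-suc j z∈ eq =
        lift-≈-slice (identity n) (threshold (Fin.suc j)) (fits-suc j) x≈id*x
          (threshold-isLift (Fin.suc j) eq) z∈

      threshold-≈-slice-inject₁ : ∀ j (z∈ : (t , s) ∈ Slice j) → proj₁ t (inject₁ j) ≈ᴿ proj₁ s →
        atThreshold (inject₁ j) ∣Cyl∣.≈ to (sliceᶜ x j) ((t , s) , z∈)
      threshold-≈-slice-inject₁ j z∈ eq =
        lift-≈-slice (identity n) (threshold (inject₁ j)) (fits-inject₁ j) x≈id*x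
          (threshold-isLift (inject₁ j) eq) z∈

      -- All coordinates from `c` to `d` equal `s`. Two consecutive thresholds both fit the slice
      -- between them and therefore give the same point, so the threshold can be moved one position
      -- at a time.
      threshold-≈ : ∀ d c → c Fin.≤ d → proj₁ t c ≈ᴿ proj₁ s → proj₁ t d ≈ᴿ proj₁ s →
                    atThreshold c ∣Cyl∣.≈ atThreshold d
      threshold-≈ = <-weakInduction _
        (λ c c≤0 _ _ → ∣Cyl∣.reflexive
          (cong atThreshold (Fin.toℕ-injective {j = Fin.zero} (ℕ.n≤0⇒n≡0 c≤0))))
        step
        where
        step : ∀ d →
          (∀ c → c Fin.≤ inject₁ d → proj₁ t c ≈ᴿ proj₁ s → proj₁ t (inject₁ d) ≈ᴿ proj₁ s →
             atThreshold c ∣Cyl∣.≈ atThreshold (inject₁ d)) →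
          ∀ c → c Fin.≤ Fin.suc d → proj₁ t c ≈ᴿ proj₁ s → proj₁ t (Fin.suc d) ≈ᴿ proj₁ s →
             atThreshold c ∣Cyl∣.≈ atThreshold (Fin.suc d)
        step d previous c c≤1+d tc≈s t1+d≈s with c Fin.≟ Fin.suc d
        ... | yes refl  = ∣Cyl∣.≈-refl
        ... | no  c≢1+d = ∣Cyl∣.≈-trans (previous c c≤d tc≈s td≈s)
          (∣Cyl∣.≈-trans (threshold-≈-slice-inject₁ d z∈ td≈s)
            (∣Cyl∣.≈-sym (threshold-≈-slice-suc d z∈ t1+d≈s)))
          where
          c≤d : c Fin.≤ inject₁ d
          c≤d = subst (toℕ c ℕ.≤_) (sym (Fin.toℕ-inject₁ d))
                  (ℕ.s≤s⁻¹ (ℕ.≤∧≢⇒< c≤1+d (c≢1+d ∘ Fin.toℕ-injective)))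

          td≈s : proj₁ t (inject₁ d) ≈ᴿ proj₁ s
          td≈s = (λ q∈ → proj₁ t1+d≈s (mono {inject₁ d} {Fin.suc d}
                   (subst (ℕ._≤ suc (toℕ d)) (sym (Fin.toℕ-inject₁ d)) (ℕ.n≤1+n _)) q∈)) ,
                 (λ q∈ → mono c≤d (proj₂ tc≈s q∈))

          z∈ : (t , s) ∈ Slice d
          z∈ = proj₁ td≈s , proj₂ t1+d≈s

      -- A point common to both slices has `s` squeezed between coordinates i + 1 and j, which are
      -- therefore equal. The thresholds at these two positions connect the slices.
      slice-≈-< : ∀ {i j} → i Fin.< j → (z∈ : (t , s) ∈ Slice i) (z∈′ : (t , s) ∈ Slice j) →
                  to (sliceᶜ x i) ((t , s) , z∈) ∣Cyl∣.≈ to (sliceᶜ x j) ((t , s) , z∈′)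
      slice-≈-< {i} {j} i<j z∈@(_ , s≤ti+1) z∈′@(tj≤s , _) =
        ∣Cyl∣.≈-trans (∣Cyl∣.≈-sym (threshold-≈-slice-suc i z∈ ti+1≈s))
          (∣Cyl∣.≈-trans (threshold-≈ (inject₁ j) (Fin.suc i) i+1≤j ti+1≈s tj≈s)
            (threshold-≈-slice-inject₁ j z∈′ tj≈s))
        where
        i+1≤j : Fin.suc i Fin.≤ inject₁ j
        i+1≤j = subst (suc (toℕ i) ℕ.≤_) (sym (Fin.toℕ-inject₁ j)) i<j

        ti+1≈s : proj₁ t (Fin.suc i) ≈ᴿ proj₁ s
        ti+1≈s = (λ q∈ → tj≤s (mono i+1≤j q∈)) , s≤ti+1

        tj≈s : proj₁ t (inject₁ j) ≈ᴿ proj₁ s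
        tj≈s = tj≤s , λ q∈ → mono i+1≤j (s≤ti+1 q∈)

  slice-cong : ∀ {n} (x : X.Simplex n) j {z z′} (z∈ : z ∈ Slice j) (z′∈ : z′ ∈ Slice j) →
               Space._≈_ (Prism n) z z′ →
               to (sliceᶜ x j) (z , z∈) ∣Cyl∣.≈ to (sliceᶜ x j) (z′ , z′∈)
  slice-cong x j {z} {z′} z∈ z′∈ z≈z′ = to-cong (sliceᶜ x j) {z , z∈} {z′ , z′∈} z≈z′

  slice-agree : ∀ {n} (x : X.Simplex n) {z z′} i j (z∈ : z ∈ Slice i) (z′∈ : z′ ∈ Slice j) →
                Space._≈_ (Prism n) z z′ →
                to (sliceᶜ x i) (z , z∈) ∣Cyl∣.≈ to (sliceᶜ x j) (z′ , z′∈)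
  slice-agree {n} x {z} {z′} i j z∈ z′∈ z≈z′@(t≈t′ , s≤s′ , s′≤s) = compare (Fin.<-cmp i j)
    where
    z∈′ : ∀ {k} → z′ ∈ Slice k → z ∈ Slice k
    z∈′ {k} (t′≤s′ , s′≤t′) = (λ q∈ → s′≤s (t′≤s′ (proj₁ (t≈t′ (inject₁ k)) q∈))) ,
                              (λ q∈ → proj₂ (t≈t′ (Fin.suc k)) (s′≤t′ (s≤s′ q∈)))

    compare : Tri (i Fin.< j) (i ≡ j) (j Fin.< i) →
              to (sliceᶜ x i) (z , z∈) ∣Cyl∣.≈ to (sliceᶜ x j) (z′ , z′∈)
    compare (tri≈ _ refl _) = slice-cong x i {z} {z′} z∈ z′∈ z≈z′
    compare (tri< i<j _ _)  = ∣Cyl∣.≈-trans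
      (slice-≈-< (proj₁ z) (proj₂ z) x i<j z∈ (z∈′ z′∈))
      (slice-cong x j {z} {z′} (z∈′ z′∈) z′∈ z≈z′)
    compare (tri> _ _ j<i)  = ∣Cyl∣.≈-trans
      (∣Cyl∣.≈-sym (slice-≈-< (proj₁ z) (proj₂ z) x j<i (z∈′ z′∈) z∈))
      (slice-cong x j {z} {z′} (z∈′ z′∈) z′∈ z≈z′)

module _ (em : ExcludedMiddle (lsuc 0ℓ)) where
  open Order (lem em)

  slice-closed : ∀ {n} (j : Fin (suc n)) → Space.Open (Prism n) (λ z → ¬ z ∈ Slice j)
  slice-closed {n} j = Space.local (Prism n) λ z z∉ → outside z z∉ (lem em)
    where
    outside : ∀ z → ¬ z ∈ Slice j → Dec (proj₁ (proj₁ z) (inject₁ j) ≤ᴿ proj₁ (proj₂ z)) →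
              Near (Prism n) z (λ z → ¬ z ∈ Slice j)
    outside z z∉ (no t≰s) = near-mono (Prism n) (λ t≰s (t≤s , _) → t≰s t≤s)
      (near-open (Prism n) (≰-open (baseᶜ (inject₁ j)) parameterᶜ) t≰s)
    outside z z∉ (yes t≤s) = near-mono (Prism n) (λ s≰t (_ , s≤t) → s≰t s≤t)
      (near-open (Prism n) (≰-open parameterᶜ (baseᶜ (Fin.suc j))) (λ s≤t → z∉ (t≤s , s≤t)))

  slice-cover : ∀ {n} (z : Space.Carrier (Prism n)) → ∃ λ j → z ∈ Slice j
  slice-cover ((t , t-simplex) , s , 0≤s , s≤1) =
    locate t s (λ q∈ → 0≤s (proj₁ start q∈)) (λ q∈ → proj₂ end (s≤1 q∈))
    where open IsSimplexPoint t-simplex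

  module _ (X : SimplicialSet c ℓ) where
    private
      module X = SimplicialSet X
      Cyl = cylinder X
      module ∣Cyl∣ = Space ∣ Cyl ∣
      module Pasted {n} (x : X.Simplex n) = Paste (lem em) {Z = Prism n} {Y = ∣ Cyl ∣}
        Slice slice-closed slice-cover (sliceᶜ X x)
        (λ {z} {z′} → slice-agree X x {z} {z′})

    prismᶜ : ∀ {n} → X.Simplex n → ContinuousMap (Prism n) ∣ Cyl ∣
    prismᶜ x = Pasted.paste x

    lift-≈-prism : ∀ {N n} {j : Fin (suc n)} (β : Mono N n) (ν : Mono N 1) → Fits j β ν →
      ∀ {x′ x} → x′ X.≈ X.act β x → ∀ {w z} → IsLift β ν w z →
      (N , (x′ , ν) , w) ∣Cyl∣.≈ to (prismᶜ x) z
    lift-≈-prism {j = j} β ν fits {x = x} x′≈β*x {w} {z} lift = ∣Cyl∣.≈-trans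
      (lift-≈-slice X β ν fits x′≈β*x {w} {z} lift z∈)
      (∣Cyl∣.≈-sym (Pasted.paste-≈ x j {z} z∈))
      where
      z∈ : z ∈ Slice j
      z∈ = lift∈slice β ν fits {w} {z} lift

    -- The map `α` carries the vertices `(i , b)` of slice `j` to vertices of slice `⟦ α ⟧ j`. Hence
    -- the point `w` that represents `(u , s)` in its slice is also a lift of `(v , s)`.
    prism-glue : ∀ {m n x y u v} → Glue X (m , x , u) (n , y , v) → ∀ s →
                 to (prismᶜ x) (u , s) ∣Cyl∣.≈ to (prismᶜ y) (v , s)
    prism-glue {m} {n} {x} {y} {u} {v} (α , x≈α*y , αu≈v) s =
      lift-≈-prism {j = ⟦ α ⟧ j} β (threshold (slot j)) fits σ*x≈β*y {w} {v , s} lift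
      where
      module x≈ {n} = Setoid (X.simplices n)
      j : Fin (suc m)
      -- `prismᶜ x` is evaluated in this very slice, so its value at `(u , s)` is by definition the
      -- left-hand side of `lift-≈-prism`.
      j = proj₁ (slice-cover (u , s))

      z∈ : (u , s) ∈ Slice j
      z∈ = proj₂ (slice-cover (u , s))

      w : Space.Carrier (Δ (suc m))
      w = simplexOfSlice j {u , s} z∈

      β : Mono (suc m) n
      β = posetHomomorphism (degeneracy j) α

      fits : Fits (⟦ α ⟧ j) β (threshold (slot j))
      fits i =
        (λ ν≡0 → ⟦⟧-mono α (<slot⇒pinch≤ j i (threshold≡0⇒< (slot j) ν≡0))) ,
        (λ ν≡1 → ⟦⟧-mono α (slot≤⇒≤pinch j i (threshold≡1⇒≥ (slot j) ν≡1)))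

      σ*x≈β*y : X.act (degeneracy j) x X.≈ X.act β y
      σ*x≈β*y = x≈.trans (X.act-cong (λ _ → refl) x≈α*y) (x≈.sym (X.act-∘ (degeneracy j) α y))

      lift : IsLift β (threshold (slot j)) w (v , s)
      lift = record
        { base      = λ k → subst (_≈ᴿ proj₁ v k)
            (trans (sym (insert-#below j (u , s) (#below α k)))
                   (cong (proj₁ w) (#below-factor (degeneracy j) α β (λ _ → refl) k)))
            (αu≈v k)
        ; parameter = IsLift.parameter (insert-isLift j {u , s} z∈)
        }

    cylinderᶜ : ContinuousMap (∣ X ∣ ×ₛ 𝕀) ∣ Cyl ∣
    cylinderᶜ = fromRealization×𝕀 em X ∣ Cyl ∣ prismᶜ
      (λ {_} {_} {_} {_} {u} {v} → prism-glue {u = u} {v})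

    -- The parameter is a partial sum, namely the weight of vertex 0 of the interval. Thus `𝟘`
    -- belongs to the constant 1 and `𝟙` to the constant 0, and the homotopy of a natural
    -- transformation runs from its target to its source.
    cylinder-start : ∀ n x t →
      to cylinderᶜ ((n , x , t) , 𝟘) ∣Cyl∣.≈ (n , (x , constant (Fin.suc Fin.zero)) , t)
    cylinder-start n x t = ∣Cyl∣.≈-sym
      (lift-≈-prism {j = Fin.zero} (identity n) (constant (Fin.suc Fin.zero))
        (λ _ → (λ ()) , λ _ → z≤n)
        (Setoid.sym (X.simplices n) (X.act-id x)) {t} {t , 𝟘} lift)
      where
      lift : IsLift (identity n) (constant (Fin.suc Fin.zero)) t (t , 𝟘)
      lift = record
        { base      = λ k → ≈ᴿ.reflexive (cong (proj₁ t) (#below-id k))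
        ; parameter = subst (λ k → proj₁ t k ≈ᴿ 0ᴿ)
            (sym (#below-unique (constant (Fin.suc Fin.zero)) {one} {Fin.zero} (λ _ ())
              (λ { _ (s≤s ()) })))
            (IsSimplexPoint.start (proj₂ t))
        }

    cylinder-end : ∀ n x t →
      to cylinderᶜ ((n , x , t) , 𝟙) ∣Cyl∣.≈ (n , (x , constant Fin.zero) , t)
    cylinder-end n x t = ∣Cyl∣.≈-sym
      (lift-≈-prism {j = fromℕ n} (identity n) (constant Fin.zero)
        (λ i → (λ _ → Fin.≤fromℕ i) , λ ())
        (Setoid.sym (X.simplices n) (X.act-id x)) {t} {t , 𝟙} lift)
      where
      lift : IsLift (identity n) (constant Fin.zero) t (t , 𝟙)
      lift = record
        { base      = λ k → ≈ᴿ.reflexive (cong (proj₁ t) (#below-id k))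
        ; parameter = subst (λ k → proj₁ t k ≈ᴿ 1ᴿ)
            (sym (#below-unique (constant Fin.zero) {one} {fromℕ (suc n)} (λ _ _ → z<s)
              (λ i _ → subst (toℕ i ℕ.<_) (sym (Fin.toℕ-fromℕ (suc n))) (Fin.toℕ<n i))))
            (IsSimplexPoint.end (proj₂ t))
        }

  module _ {X : SimplicialSet c ℓ} {Y : SimplicialSet c′ ℓ′} where
    private module Y = SimplicialSet Y
    open SimplicialMap using (map)

    realization-homotopy : (h : SimplicialMap (cylinder X) Y) (f g : SimplicialMap X Y) →
      (∀ {n} x → map h {n} (x , constant Fin.zero) Y.≈ map f x) →
      (∀ {n} x → map h {n} (x , constant (Fin.suc Fin.zero)) Y.≈ map g x) →
      Homotopy (realizationMap g) (realizationMap f)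
    realization-homotopy h f g h₀≈f h₁≈g = record
      { H       = realizationMap h ∘ᶜ cylinderᶜ X
      ; atStart = λ (n , x , t) → Space.≈-trans ∣ Y ∣
          (to-cong (realizationMap h) (cylinder-start X n x t)) (glue-≈ Y t (h₁≈g x))
      ; atEnd   = λ (n , x , t) → Space.≈-trans ∣ Y ∣
          (to-cong (realizationMap h) (cylinder-end X n x t)) (glue-≈ Y t (h₀≈f x))
      }

-- Natural transformations

idF : {C : Category o ℓ e} → Functor C C
idF {C = C} = record
  { F₀           = id
  ; F₁           = id
  ; identity     = Category.Equiv.refl C
  ; homomorphism = λ _ _ → Category.Equiv.refl C
  ; F-resp-≈     = id
  }

module _ {C : Category o ℓ e} {D : Category o′ ℓ′ e′} where
  private
    module C = Category C
    module D = Category D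

  record NaturalTransformation (F G : Functor C D) : Set (o ⊔ˡ ℓ ⊔ˡ e ⊔ˡ o′ ⊔ˡ ℓ′ ⊔ˡ e′) where
    private
      module F = Functor F
      module G = Functor G
    field
      η       : ∀ A → F.F₀ A D.⇒ G.F₀ A
      natural : ∀ {A B} (f : A C.⇒ B) → G.F₁ f D.⊙ η A D.≈ η B D.⊙ F.F₁ f

  module _ {F G : Functor C D} (θ : NaturalTransformation F G) where
    private
      module F = Functor F
      module G = Functor G
    open NaturalTransformation θ
    open D.Equiv using () renaming (refl to ≈-refl; sym to ≈-sym; trans to ≈-trans)

    private
      H₀ : Fin 2 → C.Obj → D.Obj
      H₀ Fin.zero           = F.F₀
      H₀ (Fin.suc Fin.zero) = G.F₀

      H₁ : ∀ {A B} b b′ → b Fin.≤ b′ → A C.⇒ B → H₀ b A D.⇒ H₀ b′ B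
      H₁ {A} Fin.zero           Fin.zero           _ f = F.F₁ f
      H₁ {A} Fin.zero           (Fin.suc Fin.zero) _ f = G.F₁ f D.⊙ η A
      H₁ {A} (Fin.suc Fin.zero) (Fin.suc Fin.zero) _ f = G.F₁ f

      H-resp : ∀ {A B} b b′ (p q : b Fin.≤ b′) {f g : A C.⇒ B} → f C.≈ g →
               H₁ b b′ p f D.≈ H₁ b b′ q g
      H-resp Fin.zero           Fin.zero           _ _ f≈g = F.F-resp-≈ f≈g
      H-resp Fin.zero           (Fin.suc Fin.zero) _ _ f≈g = D.⊙-resp-≈ (G.F-resp-≈ f≈g) ≈-refl
      H-resp (Fin.suc Fin.zero) (Fin.suc Fin.zero) _ _ f≈g = G.F-resp-≈ f≈g

      H-identity : ∀ {A} b (p : b Fin.≤ b) → H₁ b b p (C.idn {A}) D.≈ D.idn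
      H-identity Fin.zero           _ = F.identity
      H-identity (Fin.suc Fin.zero) _ = G.identity

      H-homomorphism : ∀ {A B E} b b′ b″ (p : b Fin.≤ b′) (q : b′ Fin.≤ b″) (r : b Fin.≤ b″)
        (g : B C.⇒ E) (f : A C.⇒ B) →
        H₁ b b″ r (g C.⊙ f) D.≈ H₁ b′ b″ q g D.⊙ H₁ b b′ p f
      H-homomorphism Fin.zero Fin.zero Fin.zero _ _ _ g f = F.homomorphism g f
      -- Naturality enters only here, where `f` stays at 0 and `g` crosses to 1.
      H-homomorphism {A} {B} Fin.zero Fin.zero (Fin.suc Fin.zero) _ _ _ g f =
        ≈-trans (D.⊙-resp-≈ (G.homomorphism g f) ≈-refl)
        (≈-trans (D.assoc _ _ _)
        (≈-trans (D.⊙-resp-≈ ≈-refl (natural f)) (≈-sym (D.assoc _ _ _))))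
      H-homomorphism Fin.zero (Fin.suc Fin.zero) (Fin.suc Fin.zero) _ _ _ g f =
        ≈-trans (D.⊙-resp-≈ (G.homomorphism g f) ≈-refl) (D.assoc _ _ _)
      H-homomorphism (Fin.suc Fin.zero) (Fin.suc Fin.zero) (Fin.suc Fin.zero) _ _ _ g f =
        G.homomorphism g f

      H-resp-≋ : ∀ {A B A′ B′} {f : A C.⇒ B} {g : A′ C.⇒ B′} {b b′ c c′}
                 (p : b Fin.≤ b′) (q : c Fin.≤ c′) → f C.≋ g → b ≡ c → b′ ≡ c′ →
                 H₁ b b′ p f D.≋ H₁ c c′ q g
      H-resp-≋ p q (C.same f≈g) refl refl = D.same (H-resp _ _ p q f≈g)

    naturalMap : SimplicialMap (cylinder (nerve C)) (nerve D)
    naturalMap = record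
      { map      = λ (x , ν) → let ν-mono = ⟦⟧-mono ν in record
        { F₀           = λ i → H₀ (⟦ ν ⟧ i) (Functor.F₀ x i)
        ; F₁           = λ i≤j → H₁ _ _ (⟦⟧-mono ν i≤j) (Functor.F₁ x i≤j)
        ; identity     = λ {i} → ≈-trans
            (H-resp (⟦ ν ⟧ i) (⟦ ν ⟧ i) (ν-mono Fin.≤-refl) (ν-mono Fin.≤-refl)
              (Functor.identity x))
            (H-identity (⟦ ν ⟧ i) (ν-mono Fin.≤-refl))
        ; homomorphism = λ {i} {j} {k} q p →
            ≈-trans
              (H-resp (⟦ ν ⟧ i) (⟦ ν ⟧ k) (ν-mono (Fin.≤-trans p q)) (ν-mono (Fin.≤-trans p q))
                (Functor.homomorphism x q p))
              (H-homomorphism (⟦ ν ⟧ i) (⟦ ν ⟧ j) (⟦ ν ⟧ k) (ν-mono p) (ν-mono q)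
                (ν-mono (Fin.≤-trans p q)) (Functor.F₁ x q) (Functor.F₁ x p))
        ; F-resp-≈     = λ {i} {j} {p} {q} _ →
            H-resp (⟦ ν ⟧ i) (⟦ ν ⟧ j) (ν-mono p) (ν-mono q) (Functor.F-resp-≈ x _)
        }
      ; map-cong = λ {_} {(_ , ν)} {(_ , μ)} (x≈y , ν≗μ) {i} {j} i≤j →
          H-resp-≋ (⟦⟧-mono ν i≤j) (⟦⟧-mono μ i≤j) (x≈y i≤j) (ν≗μ i) (ν≗μ j)
      ; natural  = λ _ _ _ → D.≋-refl
      }

    naturalHomotopy : ExcludedMiddle (lsuc 0ℓ) → Homotopy (B₁ G) (B₁ F)
    naturalHomotopy em = realization-homotopy em naturalMap (nerveMap F) (nerveMap G)
      (λ _ _ → D.≋-refl) (λ _ _ → D.≋-refl)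

  B₁-cong : (F G : Functor C D) → (∀ {A B} (f : A C.⇒ B) → Functor.F₁ F f D.≋ Functor.F₁ G f) →
            ∀ x → Space._≈_ (B D) (ContinuousMap.to (B₁ F) x) (ContinuousMap.to (B₁ G) x)
  B₁-cong F G F≈G (n , x , t) = glue-≈ (nerve D) t (λ _ → F≈G _)

module _ {C : Category o ℓ e} {D : Category o′ ℓ′ e′} where
  private
    module C = Category C
    module D = Category D

  B₁-isHomotopyEquivalence : (F : Functor C D) (G : Functor D C) →
    Homotopy (B₁ (G ∘F F)) (B₁ idF) → Homotopy (B₁ (F ∘F G)) (B₁ idF) →
    IsHomotopyEquivalence (B₁ F)
  B₁-isHomotopyEquivalence F G GF~id FG~id = record
    { inverse      = B₁ G
    -- `B₁ (G ∘F F)` and `B₁ G ∘ᶜ B₁ F` yield simplices with the same arrows but different proof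
    -- fields; gluing along the identity identifies them.
    ; leftInverse  = homotopy-resp-≗
        (λ (_ , _ , t) → glue-≈ (nerve C) t (λ _ → C.≋-refl))
        (λ (_ , _ , t) → glue-≈ (nerve C) t (λ _ → C.≋-refl)) GF~id
    ; rightInverse = homotopy-resp-≗
        (λ (_ , _ , t) → glue-≈ (nerve D) t (λ _ → D.≋-refl))
        (λ (_ , _ , t) → glue-≈ (nerve D) t (λ _ → D.≋-refl)) FG~id
    }

  B₁-homotopy : {F G : Functor C D} →
    (∀ {A B} (f : A C.⇒ B) → Functor.F₁ F f D.≋ Functor.F₁ G f) → Homotopy (B₁ F) (B₁ G)
  B₁-homotopy {F} {G} F≈G =
    homotopy-resp-≗ (λ _ → Space.≈-refl (B D)) (B₁-cong F G F≈G) (homotopy-refl {f = B₁ F})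

-- Sets of fixed cardinality and the symmetric group

module _ (n : ℕ) where
  open SetOfCardinality

  permutations : Functor (oneObject (symmetricGroup n)) (𝓢 n)
  permutations = record
    { F₀           = λ _ → record { Carrier = Fin n ; cardinality = ↔-id _ }
    ; F₁           = id
    ; identity     = λ _ → refl
    ; homomorphism = λ _ _ _ → refl
    ; F-resp-≈     = id
    }

  enumerate : Functor (𝓢 n) (oneObject (symmetricGroup n))
  enumerate = record
    { F₀           = _
    ; F₁           = λ {X} {Y} f → ↔-sym (cardinality Y) ↔-∘ (f ↔-∘ cardinality X)
    ; identity     = λ {X} → Inverse.strictlyInverseʳ (cardinality X)
    ; homomorphism = λ {X} {Y} {Z} g f i → cong (Inverse.from (cardinality Z) ∘ Inverse.to g)
        (sym (Inverse.strictlyInverseˡ (cardinality Y) _))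
    ; F-resp-≈     = λ {X} {Y} f≗g i → cong (Inverse.from (cardinality Y)) (f≗g _)
    }

  B𝓢≃BS : ExcludedMiddle (lsuc 0ℓ) → B (𝓢 n) ≃ B (oneObject (symmetricGroup n))
  B𝓢≃BS em = B₁ enumerate , B₁-isHomotopyEquivalence enumerate permutations
    -- The transformation goes out of the identity, so its homotopy already starts at the composite,
    -- as a left inverse requires.
    (naturalHomotopy {F = idF} {G = permutations ∘F enumerate} θ em)
    -- `Fin n` is enumerated by the identity, so this composite fixes every permutation.
    (B₁-homotopy {F = enumerate ∘F permutations} {G = idF} (λ _ → Category.same (λ _ → refl)))
    where
    θ : NaturalTransformation idF (permutations ∘F enumerate)
    θ = record
      { η       = λ X → ↔-sym (cardinality X)
      ; natural = λ {X} {Y} f x → cong (Inverse.from (cardinality Y) ∘ Inverse.to f)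
          (Inverse.strictlyInverseˡ (cardinality X) x)
      }

-- Graphs

module _ {G G′ : Graph} where
  private
    module G  = Graph G
    module G′ = Graph G′

  monomorphism : (fᵥ : G.Vertex → G′.Vertex) (fₕ : G.HalfEdge → G′.HalfEdge) →
    Injective _≡_ _≡_ fᵥ → (∀ v′ → ∃ λ v → fᵥ v ≡ v′) → Injective _≡_ _≡_ fₕ →
    (∀ h → fₕ (G.τ h) ≡ G′.τ (fₕ h)) → (∀ h → fᵥ (G.∂ h) ≡ G′.∂ (fₕ h)) →
    Monomorphism G G′
  monomorphism fᵥ fₕ fᵥ-injective fᵥ-surjective fₕ-injective fₕ-τ f-∂ = record
    { morphism     = record
      { map   = Sum.map fᵥ fₕ
      ; map-τ = λ { (inj₁ _) → refl ; (inj₂ h) → cong inj₂ (fₕ-τ h) }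
      ; map-∂ = λ { (inj₁ _) → refl ; (inj₂ h) → cong inj₁ (f-∂ h) }
      }
    ; injective    = λ
      { {inj₁ _} {inj₁ _} p → cong inj₁ (fᵥ-injective (inj₁-injective p))
      ; {inj₂ _} {inj₂ _} p → cong inj₂ (fₕ-injective (inj₂-injective p))
      }
    ; onVertices   = λ v → fᵥ v , refl
    ; ontoVertices = λ v′ → let v , p = fᵥ-surjective v′ in v , cong inj₁ p
    ; onHalfEdges  = λ h → fₕ h , refl
    }

  module _ (f : Monomorphism G G′) where
    open Monomorphism f

    onVertex : G.Vertex → G′.Vertex
    onVertex = proj₁ ∘ onVertices

    onHalfEdge : G.HalfEdge → G′.HalfEdge
    onHalfEdge = proj₁ ∘ onHalfEdges

    onVertex-injective : Injective _≡_ _≡_ onVertex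
    onVertex-injective {v} {w} p = inj₁-injective (injective
      (trans (proj₂ (onVertices v)) (trans (cong inj₁ p) (sym (proj₂ (onVertices w))))))

    onHalfEdge-injective : Injective _≡_ _≡_ onHalfEdge
    onHalfEdge-injective {h} {k} p = inj₂-injective (injective
      (trans (proj₂ (onHalfEdges h)) (trans (cong inj₂ p) (sym (proj₂ (onHalfEdges k))))))

    onVertex-surjective : ∀ v′ → ∃ λ v → onVertex v ≡ v′
    onVertex-surjective v′ = let v , p = ontoVertices v′ in
      v , inj₁-injective (trans (sym (proj₂ (onVertices v))) p)

    onHalfEdge-τ : ∀ h → onHalfEdge (G.τ h) ≡ G′.τ (onHalfEdge h)
    onHalfEdge-τ h = inj₂-injective
      (trans (sym (proj₂ (onHalfEdges (G.τ h))))
      (trans (map-τ (inj₂ h)) (cong G′.τ⁺ (proj₂ (onHalfEdges h)))))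

    onVertex-∂ : ∀ h → onVertex (G.∂ h) ≡ G′.∂ (onHalfEdge h)
    onVertex-∂ h = inj₁-injective
      (trans (sym (proj₂ (onVertices (G.∂ h))))
      (trans (map-∂ (inj₂ h)) (cong G′.∂⁺ (proj₂ (onHalfEdges h)))))

  onHalfEdge-cong : (f g : Monomorphism G G′) →
    (∀ x → Monomorphism.map f x ≡ Monomorphism.map g x) → ∀ h → onHalfEdge f h ≡ onHalfEdge g h
  onHalfEdge-cong f g f≗g h = inj₂-injective
    (trans (sym (proj₂ (Monomorphism.onHalfEdges f h)))
    (trans (f≗g (inj₂ h)) (proj₂ (Monomorphism.onHalfEdges g h))))

-- The half-edges of the graph whose edges are all ordered pairs of vertices, loops
-- included.
module _ {X : Set} where

  Arrow : Set
  Arrow = (X × X) × Fin 2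

  endpoint : Arrow → X
  endpoint ((v , w) , Fin.zero)         = v
  endpoint ((v , w) , Fin.suc Fin.zero) = w

-- With ordered pairs no quotient is formed and equality of vertices is never decided. The labels in
-- `Fin 2` keep the two half-edges of a loop apart.
completeGraph : (X : Set) → Finite X → Graph
completeGraph X X-finite@(_ , X-cardinality) = record
  { Vertex          = X
  ; Edge            = X × X
  ; HalfEdge        = Arrow
  ; vertices-finite = X-finite
  ; edges-finite    = _ , (X-cardinality ×-↔ X-cardinality) ↔-∘ Fin.*↔×
  ; covering        = proj₁
  ; twoFold         = λ e → mk↔ₛ′ (λ i → (e , i) , refl) (λ ((_ , i) , _) → i)
                            (λ { ((_ , _) , refl) → refl }) (λ _ → refl)
  ; ∂               = endpoint
  }

mapArrow : ∀ {X Y : Set} → (X → Y) → Arrow {X} → Arrow {Y}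
mapArrow f ((v , w) , i) = (f v , f w) , i

mapArrow-injective : ∀ {X Y : Set} {f : X → Y} →
                     Injective _≡_ _≡_ f → Injective _≡_ _≡_ (mapArrow f)
mapArrow-injective f-injective p = cong₂ _,_
  (cong₂ _,_ (f-injective (cong (proj₁ ∘ proj₁) p)) (f-injective (cong (proj₂ ∘ proj₁) p)))
  (cong proj₂ p)

endpoint-mapArrow : ∀ {X Y : Set} (f : X → Y) h → f (endpoint h) ≡ endpoint (mapArrow f h)
endpoint-mapArrow f (_ , Fin.zero)         = refl
endpoint-mapArrow f (_ , Fin.suc Fin.zero) = refl

-- Edges of `K` are added even when parallel to edges of `G`. This keeps the edge set a plain sum,
-- on which monomorphisms act summand by summand.
overlay : (G K : Graph) → (Graph.Vertex K → Graph.Vertex G) → Graph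
overlay G K φ = record
  { Vertex          = G.Vertex
  ; Edge            = G.Edge ⊎ K.Edge
  ; HalfEdge        = G.HalfEdge ⊎ K.HalfEdge
  ; vertices-finite = G.vertices-finite
  ; edges-finite    = _ , (proj₂ G.edges-finite ⊎-↔ proj₂ K.edges-finite) ↔-∘ Fin.+↔⊎
  ; covering        = Sum.map G.covering K.covering
  ; twoFold         = λ { (inj₁ e) → fibre₁ e ↔-∘ G.twoFold e
                        ; (inj₂ e) → fibre₂ e ↔-∘ K.twoFold e }
  ; ∂               = Sum.[ G.∂ , φ ∘ K.∂ ]
  }
  where
  module G = Graph G
  module K = Graph K

  covering : G.HalfEdge ⊎ K.HalfEdge → G.Edge ⊎ K.Edge
  covering = Sum.map G.covering K.covering

  fibre₁ : ∀ e → (∃ λ h → G.covering h ≡ e) ↔ (∃ λ h → covering h ≡ inj₁ e)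
  fibre₁ e = mk↔ₛ′ (λ (h , p) → inj₁ h , cong inj₁ p)
    (λ { (inj₁ h , p) → h , inj₁-injective p })
    (λ { (inj₁ h , refl) → refl }) (λ { (h , refl) → refl })

  fibre₂ : ∀ e → (∃ λ h → K.covering h ≡ e) ↔ (∃ λ h → covering h ≡ inj₂ e)
  fibre₂ e = mk↔ₛ′ (λ (h , p) → inj₂ h , cong inj₂ p)
    (λ { (inj₂ h , p) → h , inj₂-injective p })
    (λ { (inj₂ h , refl) → refl }) (λ { (h , refl) → refl })

-- The functors between graphs and sets, and the zigzag

module _ (r : ℕ) where
  open SetOfCardinality

  complete : Functor (𝓢 (suc r)) (m𝓖 r)
  complete = record
    { F₀           = λ X → record
      { graph     = completeGraph (Carrier X) (_ , cardinality X)
      ; order     = cardinality X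
      ; connected = λ v w → (((v , w) , Fin.zero) , refl , refl) ◅ ε
      }
    ; F₁           = λ f → monomorphism (Inverse.to f) (mapArrow (Inverse.to f))
        (to-injective f) (λ y → Inverse.from f y , Inverse.strictlyInverseˡ f y)
        (mapArrow-injective (to-injective f)) (λ _ → refl) (endpoint-mapArrow (Inverse.to f))
    ; identity     = λ { (inj₁ _) → refl ; (inj₂ _) → refl }
    ; homomorphism = λ { _ _ (inj₁ _) → refl ; _ _ (inj₂ _) → refl }
    ; F-resp-≈     = λ
      { f≗g (inj₁ v)             → cong inj₁ (f≗g v)
      ; f≗g (inj₂ ((v , w) , i)) → cong₂ (λ v w → inj₂ ((v , w) , i)) (f≗g v) (f≗g w)
      }
    }
    where
    to-injective : ∀ {X Y : Set} (f : X ↔ Y) → Injective _≡_ _≡_ (Inverse.to f)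
    to-injective f {x} {y} p = trans (sym (Inverse.strictlyInverseʳ f x))
      (trans (cong (Inverse.from f) p) (Inverse.strictlyInverseʳ f y))

  addComplete : Functor (m𝓖 r) (m𝓖 r)
  addComplete = record
    { F₀           = λ G → let open ConnectedGraph G in record
      { graph     = overlay graph (completeGraph Vertex vertices-finite) id
      ; order     = order
      ; connected = λ v w → (inj₂ ((v , w) , Fin.zero) , refl , refl) ◅ ε
      }
    ; F₁           = λ f → monomorphism (onVertex f)
        (Sum.map (onHalfEdge f) (mapArrow (onVertex f)))
        (onVertex-injective f) (onVertex-surjective f)
        (λ { {inj₁ _} {inj₁ _} p → cong inj₁ (onHalfEdge-injective f (inj₁-injective p))
           ; {inj₂ _} {inj₂ _} p →
               cong inj₂ (mapArrow-injective (onVertex-injective f) (inj₂-injective p)) })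
        (λ { (inj₁ h) → cong inj₁ (onHalfEdge-τ f h) ; (inj₂ _) → refl })
        (λ { (inj₁ h) → onVertex-∂ f h ; (inj₂ h) → endpoint-mapArrow (onVertex f) h })
    ; identity     = λ { (inj₁ _) → refl ; (inj₂ (inj₁ _)) → refl ; (inj₂ (inj₂ _)) → refl }
    ; homomorphism = λ { _ _ (inj₁ _) → refl ; _ _ (inj₂ (inj₁ _)) → refl
                       ; _ _ (inj₂ (inj₂ _)) → refl }
    ; F-resp-≈     = λ {G} {H} {f} {g} f≗g → let fᵥ≗gᵥ = V.F-resp-≈ {G} {H} {f} {g} f≗g in λ
      { (inj₁ v)                    → cong inj₁ (fᵥ≗gᵥ v)
      ; (inj₂ (inj₁ h))             → cong (inj₂ ∘ inj₁) (onHalfEdge-cong f g f≗g h)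
      ; (inj₂ (inj₂ ((v , w) , i))) →
          cong₂ (λ v w → inj₂ (inj₂ ((v , w) , i))) (fᵥ≗gᵥ v) (fᵥ≗gᵥ w)
      }
    }
    where module V = Functor (vertexFunctor r)

  graphInclusion : NaturalTransformation idF addComplete
  graphInclusion = record
    { η       = λ G → monomorphism id inj₁ id (λ v → v , refl) inj₁-injective
                        (λ _ → refl) (λ _ → refl)
    ; natural = λ f → λ
      -- `addComplete` rebuilds `f` from its parts on vertices and on half-edges, which match
      -- `map f` only through the stored equations.
      { (inj₁ v) → cong (Sum.map id inj₁) (sym (proj₂ (Monomorphism.onVertices f v)))
      ; (inj₂ h) → cong (Sum.map id inj₁) (sym (proj₂ (Monomorphism.onHalfEdges f h)))
      }
    }

  completeInclusion : NaturalTransformation (complete ∘F vertexFunctor r) addComplete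
  completeInclusion = record
    { η       = λ G → monomorphism id inj₂ id (λ v → v , refl) inj₂-injective
                        (λ _ → refl) (λ _ → refl)
    ; natural = λ { f (inj₁ _) → refl ; f (inj₂ _) → refl }
    }

  vertexFunctor-isHomotopyEquivalence :
    ExcludedMiddle (lsuc 0ℓ) → IsHomotopyEquivalence (B₁ (vertexFunctor r))
  vertexFunctor-isHomotopyEquivalence em = B₁-isHomotopyEquivalence (vertexFunctor r) complete
    -- Both transformations end at `addComplete`, so both homotopies start there and one has to be
    -- reversed.
    (homotopy-trans (lem em)
      (homotopy-sym (lem em) (naturalHomotopy completeInclusion em))
      (naturalHomotopy graphInclusion em))
    (B₁-homotopy {F = vertexFunctor r ∘F complete} {G = idF} (λ _ → Category.same (λ _ → refl)))

theorem4p5 : ExcludedMiddle (lsuc 0ℓ) → (r : ℕ) →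
    IsHomotopyEquivalence (B₁ (vertexFunctor r)) ×
    (B (𝓢 (suc r)) ≃ B (oneObject (symmetricGroup (suc r))))
theorem4p5 em r = vertexFunctor-isHomotopyEquivalence r em , B𝓢≃BS (suc r) em
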